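{- For every real $\mu>1$, there is no deterministic $\mu$-robust algorithm for unweighted SPPT with competitive ratio less than $2$. That is, for every $\mu>1$, every deterministic online algorithm $\mathrm{ALG}$ (which may depend on $\mu$) and every $c<2$, there is an unweighted SPPT input $Q$ with $\tilde p_q\le p_q<\mu\,\tilde p_q$ for every $q\in Q$ such that $F^{\mathrm{ALG}}(Q)>c\cdot F^{\mathrm{OPT}}(Q)$.
   Context: Unweighted scheduling with predicted processing time (SPPT), single machine. An input is a finite set $Q$ of jobs; each job $q$ has a processing time $p_q>0$, a release time $r_q\ge 0$, a predicted processing time $\tilde p_q>0$, and weight $1$. At each time the machine processes at most one released, uncompleted job, at unit rate, with preemption allowed. Job $q$ completes at the time $c_q$ at which it has received $p_q$ units of processing. The cost of a schedule is the total flow time $F=\sum_{q\in Q}(c_q-r_q)$. An online algorithm learns of $q$ only at time $r_q$, when it is told $\tilde p_q$ but not $p_q$; it observes completions when they happen, and its decisions at time $t$ depend only on information revealed up to time $t$. $F^{\mathrm{OPT}}(Q)$ is the minimum cost of an offline schedule knowing the entire input. An algorithm with a competitiveness guarantee is $\mu$-robust if the guarantee holds for all inputs with $\tilde p_q\le p_q<\mu\tilde p_q$ for every job $q$. -}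

module Defs where

open import Algebra.Bundles using (CommutativeRing)
open import Algebra.Structures using (IsCommutativeRing)
open import Data.Fin.Base as Fin using (Fin; toℕ)
open import Data.Maybe.Base as Maybe using (Maybe; just)
open import Data.Nat.Base as ℕ using (ℕ)
open import Data.Product.Base using (_×_; ∃; Σ)
open import Level using (0ℓ)
open import Relation.Binary.Core using (Rel)
open import Relation.Binary.PropositionalEquality.Core using (_≡_; _≢_)
open import Relation.Binary.Structures using (IsStrictTotalOrder)
open import Relation.Unary using (Pred; Satisfiable; _≐_; _∪_; _∩_; _∖_; _⊥_; ⋃)
import Algebra.Properties.CommutativeMonoid.Sum
import Algebra.Properties.Monoid.Mult
import Relation.Binary.Construct.StrictToNonStrict

-- The reals, characterised up to isomorphism as the Dedekind-complete ordered
-- field.  The order is classical: trichotomy is decidable and suprema exist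
-- for arbitrary inhabited bounded sets.  Classically `archimedean` follows
-- from `supremum`; constructively it has to be listed.
record RealNumbers : Set₁ where
  infix  4 _<_
  infix  8 -_
  infixl 7 _*_
  infixl 6 _+_ _-_
  field
    Carrier            : Set
    _<_                : Rel Carrier 0ℓ
    _+_ _*_            : Carrier → Carrier → Carrier
    -_                 : Carrier → Carrier
    0# 1#              : Carrier
    isCommutativeRing  : IsCommutativeRing _≡_ _+_ _*_ -_ 0# 1#
    isStrictTotalOrder : IsStrictTotalOrder _≡_ _<_
    0<1                : 0# < 1#
    inverse            : ∀ x → x ≢ 0# → ∃ λ y → x * y ≡ 1#
    +-monoʳ-<          : ∀ x {y z} → y < z → x + y < x + z
    *-pos              : ∀ {x y} → 0# < x → 0# < y → 0# < x * y

  _-_ : Carrier → Carrier → Carrier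
  x - y = x + (- y)

  open Relation.Binary.Construct.StrictToNonStrict _≡_ _<_ public using (_≤_)

  commutativeRing : CommutativeRing 0ℓ 0ℓ
  commutativeRing = record { isCommutativeRing = isCommutativeRing }

  open Algebra.Properties.CommutativeMonoid.Sum
    (CommutativeRing.+-commutativeMonoid commutativeRing) public
    using (sum)
  open Algebra.Properties.Monoid.Mult
    (CommutativeRing.+-monoid commutativeRing) public
    using () renaming (_×_ to _·_)

  UpperBound : Pred Carrier 0ℓ → Pred Carrier 0ℓ
  UpperBound P u = ∀ x → P x → x ≤ u

  field
    archimedean : ∀ x → ∃ λ n → x < n · 1#
    supremum    : ∀ P → Satisfiable P → Satisfiable (UpperBound P) →
                  ∃ λ s → UpperBound P s × (∀ u → UpperBound P u → s ≤ u)

  [_,_⟩ : Carrier → Carrier → Pred Carrier 0ℓ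
  [ a , b ⟩ t = a ≤ t × t < b

  _⟶_ : (ℕ → Carrier) → Carrier → Set
  x ⟶ l = ∀ ε → 0# < ε → ∃ λ N → ∀ n → N ℕ.≤ n → (l - ε < x n) × (x n < l + ε)

-- The measure of the sets of finite Lebesgue measure, given by its usual
-- characterisation: a countably additive extension of interval length.
-- Restricting to sets of finite measure avoids the value ∞.
record LebesgueMeasure (ℝ : RealNumbers) : Set₁ where
  open RealNumbers ℝ
  field
    Measurable : Pred Carrier 0ℓ → Set
    measure    : ∀ {A} → Measurable A → Carrier

    resp-≐       : ∀ {A B} → A ≐ B → Measurable A → Measurable B
    measure-cong : ∀ {A B} → A ≐ B → (a : Measurable A) (b : Measurable B) →
                   measure a ≡ measure b

    interval         : ∀ a b → Measurable [ a , b ⟩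
    measure-interval : ∀ {a b} → a ≤ b → measure (interval a b) ≡ b - a

    union        : ∀ {A B} → Measurable A → Measurable B → Measurable (A ∪ B)
    intersection : ∀ {A B} → Measurable A → Measurable B → Measurable (A ∩ B)
    difference   : ∀ {A B} → Measurable A → Measurable B → Measurable (A ∖ B)

    measure-nonneg : ∀ {A} (a : Measurable A) → 0# ≤ measure a
    measure-union  : ∀ {A B} (a : Measurable A) (b : Measurable B) → A ⊥ B →
                     measure (union a b) ≡ measure a + measure b
    measure-⋃      : ∀ (A : ℕ → Pred Carrier 0ℓ) (a : ∀ k → Measurable (A k)) →
                     (∀ j k → j ≢ k → A j ⊥ A k) →
                     ∀ l → (λ n → sum {n} (λ k → measure (a (toℕ k)))) ⟶ l →
                     Σ (Measurable (⋃ ℕ A)) λ u → measure u ≡ l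

module SPPT (ℝ : RealNumbers) (leb : LebesgueMeasure ℝ) where
  open RealNumbers ℝ
  open LebesgueMeasure leb

  record Job : Set where
    field
      processing release predicted : Carrier
      processing-pos : 0# < processing
      release-nonneg : 0# ≤ release
      predicted-pos  : 0# < predicted

  -- Jobs are numbered in order of release (ties broken arbitrarily), so that
  -- the number of a job carries no information about jobs yet to come.
  record Input : Set where
    field
      size   : ℕ
      job    : Fin size → Job
      sorted : ∀ {i j} → i Fin.≤ j → Job.release (job i) ≤ Job.release (job j)

    JobId : Set
    JobId = Fin size

    p r p̃ : JobId → Carrier
    p q = Job.processing (job q)
    r q = Job.release (job q)
    p̃ q = Job.predicted (job q)

  -- Single-machine preemptive schedules.  Since `running` is a function of
  -- time, at most one job is processed at each time.
  record Schedule (Q : Input) : Set where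
    open Input Q
    field
      running : Carrier → Maybe JobId

    RunsBefore : JobId → Carrier → Pred Carrier 0ℓ
    RunsBefore q t s = [ 0# , t ⟩ s × running s ≡ just q

    field
      measurable : ∀ q t → Measurable (RunsBefore q t)

    received : JobId → Carrier → Carrier
    received q t = measure (measurable q t)

    field
      completion            : JobId → Carrier
      received-completion   : ∀ q → received q (completion q) ≡ p q
      received-<-completion : ∀ q t → t < completion q → received q t < p q
      released-uncompleted  : ∀ {q t} → running t ≡ just q →
                              r q ≤ t × t < completion q

    flowTime : Carrier
    flowTime = sum (λ q → completion q - r q)

  open Schedule public using (flowTime)

  IsOptimal : ∀ {Q} → Schedule Q → Set
  IsOptimal {Q} S = ∀ (S′ : Schedule Q) → flowTime S ≤ flowTime S′

  data Event : Set where
    arrival : (number : ℕ) (release predicted : Carrier) → Event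
    finish  : (number : ℕ) (time : Carrier) → Event

  -- The information available at time t when schedule S is followed.
  data Revealed {Q} (S : Schedule Q) (t : Carrier) : Pred Event 0ℓ where
    arrived  : ∀ q → Input.r Q q ≤ t →
               Revealed S t (arrival (toℕ q) (Input.r Q q) (Input.p̃ Q q))
    finished : ∀ q → Schedule.completion S q ≤ t →
               Revealed S t (finish (toℕ q) (Schedule.completion S q))

  decision : ∀ {Q} → Schedule Q → Carrier → Maybe ℕ
  decision S t = Maybe.map toℕ (Schedule.running S t)

  -- A deterministic online algorithm: the decision at time t is the same on
  -- any two inputs on which the same information has been revealed.
  record OnlineAlgorithm : Set where
    field
      schedule        : ∀ Q → Schedule Q
      nonanticipative : ∀ Q Q′ t →
                        Revealed (schedule Q) t ≐ Revealed (schedule Q′) t →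
                        decision (schedule Q) t ≡ decision (schedule Q′) t

  PredictionsWithin : Carrier → Input → Set
  PredictionsWithin μ Q = ∀ q → p̃ q ≤ p q × p q < μ * p̃ q
    where open Input Q

module Submission where

-- The adversary releases k pairs of jobs with rapidly decreasing predictions,
-- a pair with prediction s being followed by the next pair s time units later,
-- and then, from time T on, m unit jobs, one per unit of time. In each pair one
-- job is long, of size (1 + κ) s, and one is short, of size s. The optimal
-- schedule completes every short job by the time the next pair arrives, then each
-- unit job as it arrives, and only then the long ones, so that about k + 1 jobs
-- are alive during the m units of time.
--
-- The algorithm does not know which job of a pair is short. It is run on the
-- input in which all jobs are long. In the time until T it can give a pair with
-- prediction s only slightly more than s units of work, because all later pairs
-- are tiny compared with κ s. So no job completes before T, and the job of the
-- pair that has received less is far from having received s. Declaring exactly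
-- these jobs short changes nothing that the algorithm can observe before T
-- (`shorten`, `indistinguishable`). At T all 2 k jobs are alive and each needs at
-- least one more unit of work, so that completing any of them is no faster than
-- completing a unit job (`completion-rate`). Hence at least 2 k + 1 jobs are alive
-- during the m units of time, and for large m the ratio of flow times approaches
-- (2 k + 1) / (k + 1), which tends to 2 (`horizon`).
--
-- An optimal schedule has to be exhibited, not only bounded. The one described
-- above completes, at every time, at least as many jobs as any other schedule
-- could have completed (`dominance`), and counts of completed jobs determine the
-- sum of completion times (`count-dominance`). The same comparison of counts
-- turns the rate bound for the algorithm into a bound on its flow time.

open import Defs
open import Algebra.Bundles using (CommutativeRing)
open import Data.Bool.Base using (Bool; true; false; not)
open import Data.Fin.Base as Fin using (Fin; zero; suc; punchIn)
open import Data.Fin.Properties as Fin using (any?)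
open import Data.Maybe.Base as Maybe using (Maybe; just; nothing)
import Data.Maybe.Properties as Maybe
open import Data.Nat.Base as ℕ using (ℕ; zero; suc)
import Data.Nat.Properties as ℕ
open import Data.Product.Base using (_×_; _,_; ∃; proj₁; proj₂)
open import Data.Sum.Base using (_⊎_; inj₁; inj₂)
open import Data.Unit.Base using (⊤; tt)
open import Data.Vec.Base using (Vec; []; _∷_)
open import Data.Vec.Functional using (removeAt)
open import Function.Base using (_∘_)
open import Relation.Binary.Bundles using (StrictTotalOrder; DecTotalOrder)
open import Relation.Binary.Definitions using (tri<; tri≈; tri>)
open import Relation.Binary.PropositionalEquality
  using (_≡_; refl; sym; trans; cong; cong₂; subst; subst₂)
open import Relation.Nullary using (¬_; Dec; yes; no; contradiction)
open import Relation.Nullary.Decidable using (_×-dec_; ¬?)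
open import Relation.Unary using (Pred; Decidable; _⊆_; _≐_)
import Algebra.Properties.CommutativeMonoid.Sum
import Algebra.Properties.Monoid.Mult
import Algebra.Solver.Ring.NaturalCoefficients.Default
import Relation.Binary.Properties.StrictTotalOrder

-- Ordered field arithmetic

module OrderedField (ℝ : RealNumbers) where
  open RealNumbers ℝ
  open CommutativeRing commutativeRing public
    using (+-comm; +-assoc; +-identityˡ; +-identityʳ; -‿inverseʳ; -‿inverseˡ;
           *-comm; *-assoc; *-identityˡ; *-identityʳ; zeroʳ; zeroˡ; distribˡ; distribʳ;
           commutativeSemiring)

  strictTotalOrder : StrictTotalOrder _ _ _
  strictTotalOrder = record { isStrictTotalOrder = isStrictTotalOrder }

  open StrictTotalOrder strictTotalOrder public
    using (compare; _<?_) renaming (trans to <-trans; irrefl to <-irrefl)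
  open DecTotalOrder
    (Relation.Binary.Properties.StrictTotalOrder.decTotalOrder strictTotalOrder) public
    using (_≤?_)
    renaming (refl to ≤-refl; trans to ≤-trans; total to ≤-total)

  module Sum = Algebra.Properties.CommutativeMonoid.Sum
    (CommutativeRing.+-commutativeMonoid commutativeRing)
  module Mult = Algebra.Properties.Monoid.Mult
    (CommutativeRing.+-monoid commutativeRing)
  open Algebra.Solver.Ring.NaturalCoefficients.Default commutativeSemiring public
    using (solve; _:=_; _:+_; _:*_; con)

  <⇒≤ : ∀ {x y} → x < y → x ≤ y
  <⇒≤ = inj₁

  ≡⇒≤ : ∀ {x y} → x ≡ y → x ≤ y
  ≡⇒≤ = inj₂

  <-≤-trans : ∀ {x y z} → x < y → y ≤ z → x < z
  <-≤-trans x<y (inj₁ y<z)  = <-trans x<y y<z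
  <-≤-trans x<y (inj₂ refl) = x<y

  ≤-<-trans : ∀ {x y z} → x ≤ y → y < z → x < z
  ≤-<-trans (inj₁ x<y)  y<z = <-trans x<y y<z
  ≤-<-trans (inj₂ refl) y<z = y<z

  ≤⇒≯ : ∀ {x y} → x ≤ y → ¬ y < x
  ≤⇒≯ x≤y y<x = <-irrefl refl (≤-<-trans x≤y y<x)

  ≮⇒≥ : ∀ {x y} → ¬ x < y → y ≤ x
  ≮⇒≥ {x} {y} x≮y with compare x y
  ... | tri< x<y _ _ = contradiction x<y x≮y
  ... | tri≈ _ x≡y _ = inj₂ (sym x≡y)
  ... | tri> _ _ y<x = inj₁ y<x

  ≰⇒> : ∀ {x y} → ¬ x ≤ y → y < x
  ≰⇒> {x} {y} x≰y with compare x y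
  ... | tri< x<y _ _ = contradiction (inj₁ x<y) x≰y
  ... | tri≈ _ x≡y _ = contradiction (inj₂ x≡y) x≰y
  ... | tri> _ _ y<x = y<x

  +-monoˡ-< : ∀ x {y z} → y < z → y + x < z + x
  +-monoˡ-< x {y} {z} y<z = subst₂ _<_ (+-comm x y) (+-comm x z) (+-monoʳ-< x y<z)

  +-monoʳ-≤ : ∀ x {y z} → y ≤ z → x + y ≤ x + z
  +-monoʳ-≤ x (inj₁ y<z)  = inj₁ (+-monoʳ-< x y<z)
  +-monoʳ-≤ x (inj₂ refl) = ≤-refl

  +-monoˡ-≤ : ∀ x {y z} → y ≤ z → y + x ≤ z + x
  +-monoˡ-≤ x {y} {z} y≤z = subst₂ _≤_ (+-comm x y) (+-comm x z) (+-monoʳ-≤ x y≤z)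

  infixr 6 _⊕_
  _⊕_ : ∀ {a b c d} → a ≤ b → c ≤ d → a + c ≤ b + d
  _⊕_ {b = b} {c = c} a≤b c≤d = ≤-trans (+-monoˡ-≤ c a≤b) (+-monoʳ-≤ b c≤d)

  +-cancelʳ-≤ : ∀ {x y z} → x + z ≤ y + z → x ≤ y
  +-cancelʳ-≤ {z = z} xz≤yz = ≮⇒≥ λ y<x → ≤⇒≯ xz≤yz (+-monoˡ-< z y<x)

  +-cancelʳ-< : ∀ {x y z} → x + z < y + z → x < y
  +-cancelʳ-< {z = z} xz<yz = ≰⇒> λ y≤x → ≤⇒≯ (+-monoˡ-≤ z y≤x) xz<yz

  -- A Farkas certificate. The hypotheses of a linear inequality are added up to
  -- a ≤ b, and what remains is an identity without subtraction, which holds in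
  -- every commutative semiring and is left to the solver.
  linear-≤ : ∀ {x y a b} → a ≤ b → x + b ≡ y + a → x ≤ y
  linear-≤ {x} {y} {a} {b} a≤b eq =
    +-cancelʳ-≤ (≤-trans (≡⇒≤ eq) (+-monoʳ-≤ y a≤b))

  linear-< : ∀ {x y a b} → a < b → x + b ≡ y + a → x < y
  linear-< {x} {y} {a} {b} a<b eq =
    +-cancelʳ-< (≤-<-trans (≡⇒≤ eq) (+-monoʳ-< y a<b))

  -+-cancel : ∀ x y → (x - y) + y ≡ x
  -+-cancel x y = trans (+-assoc x (- y) y) (trans (cong (x +_) (-‿inverseˡ y)) (+-identityʳ x))

  +--cancel : ∀ x y → (x + y) - y ≡ x
  +--cancel x y = trans (+-assoc x y (- y)) (trans (cong (x +_) (-‿inverseʳ y)) (+-identityʳ x))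

  ≤-from-sub : ∀ {x y z} → x ≤ y - z → x + z ≤ y
  ≤-from-sub {x} {y} {z} h = subst (x + z ≤_) (-+-cancel y z) (+-monoˡ-≤ z h)

  sub-from-≤ : ∀ {x y z} → x ≤ z + y → x - y ≤ z
  sub-from-≤ {x} {y} {z} h = subst (x - y ≤_) (+--cancel z y) (+-monoˡ-≤ (- y) h)

  ≤-sub : ∀ {x y z} → x + z ≤ y → x ≤ y - z
  ≤-sub {x} {y} {z} h = +-cancelʳ-≤ (≤-trans h (≡⇒≤ (sym (-+-cancel y z))))

  +-nonneg : ∀ {x y} → 0# ≤ x → 0# ≤ y → 0# ≤ x + y
  +-nonneg {x} {y} 0≤x 0≤y = subst (_≤ x + y) (+-identityʳ 0#) (0≤x ⊕ 0≤y)

  +-pos-nonneg : ∀ {x y} → 0# < x → 0# ≤ y → 0# < x + y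
  +-pos-nonneg {x} {y} 0<x 0≤y =
    <-≤-trans 0<x (subst (_≤ x + y) (+-identityʳ x) (+-monoʳ-≤ x 0≤y))

  x<x+y : ∀ {x y} → 0# < y → x < x + y
  x<x+y {x} {y} 0<y = subst (_< x + y) (+-identityʳ x) (+-monoʳ-< x 0<y)

  <⇒0<- : ∀ {x y} → x < y → 0# < y - x
  <⇒0<- {x} {y} x<y = subst (_< y - x) (-‿inverseʳ x) (+-monoˡ-< (- x) x<y)

  x≤x+y : ∀ {x y} → 0# ≤ y → x ≤ x + y
  x≤x+y {x} {y} 0≤y = subst (_≤ x + y) (+-identityʳ x) (+-monoʳ-≤ x 0≤y)

  halve-≤ : ∀ {x y} → x + x ≤ y + y → x ≤ y
  halve-≤ {x} {y} 2x≤2y = ≮⇒≥ λ y<x → ≤⇒≯ 2x≤2y (<-trans (+-monoʳ-< y y<x) (+-monoˡ-< x y<x))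

  *-monoʳ-< : ∀ {x y z} → 0# < x → y < z → x * y < x * z
  *-monoʳ-< {x} {y} {z} 0<x y<z =
    subst₂ _<_ (+-identityˡ _)
      (trans (sym (distribˡ x (z - y) y)) (cong (x *_) (-+-cancel z y)))
      (+-monoˡ-< (x * y) (*-pos 0<x (<⇒0<- y<z)))

  *-monoʳ-≤ : ∀ {x y z} → 0# ≤ x → y ≤ z → x * y ≤ x * z
  *-monoʳ-≤ (inj₂ refl) _           = ≡⇒≤ (trans (zeroˡ _) (sym (zeroˡ _)))
  *-monoʳ-≤ (inj₁ 0<x) (inj₂ refl) = ≤-refl
  *-monoʳ-≤ (inj₁ 0<x) (inj₁ y<z)  = inj₁ (*-monoʳ-< 0<x y<z)

  *-nonneg : ∀ {x y} → 0# ≤ x → 0# ≤ y → 0# ≤ x * y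
  *-nonneg {x} {y} 0≤x 0≤y = subst (_≤ x * y) (zeroʳ x) (*-monoʳ-≤ 0≤x 0≤y)

  positiveInverse : ∀ {x} → 0# < x → ∃ λ y → 0# < y × x * y ≡ 1#
  positiveInverse {x} 0<x with inverse x (λ { refl → <-irrefl refl 0<x })
  ... | y , xy≡1 = y , 0<y , xy≡1
    where
    0<y : 0# < y
    0<y = ≰⇒> λ y≤0 → ≤⇒≯
      (subst₂ _≤_ xy≡1 (zeroʳ x) (*-monoʳ-≤ (<⇒≤ 0<x) y≤0)) 0<1

  half : ∀ {x} → 0# < x → ∃ λ y → 0# < y × y + y ≡ x
  half {x} 0<x with positiveInverse (+-pos-nonneg 0<1 (<⇒≤ 0<1))
  ... | h , 0<h , 2h≡1 = x * h , *-pos 0<x 0<h ,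
    trans (sym (distribˡ x h h))
      (trans (cong (x *_) (trans 2h 2h≡1)) (*-identityʳ x))
    where
    2h : h + h ≡ (1# + 1#) * h
    2h = sym (trans (distribʳ h 1# 1#) (cong₂ _+_ (*-identityˡ h) (*-identityˡ h)))

  ·-nonneg : ∀ n → 0# ≤ n · 1#
  ·-nonneg zero    = ≤-refl
  ·-nonneg (suc n) = +-nonneg (<⇒≤ 0<1) (·-nonneg n)

  ·-mono-≤ : ∀ {m n} → m ℕ.≤ n → m · 1# ≤ n · 1#
  ·-mono-≤ {n = n} ℕ.z≤n = ·-nonneg n
  ·-mono-≤ (ℕ.s≤s m≤n)   = +-monoʳ-≤ 1# (·-mono-≤ m≤n)

  ·-monoʳ-≤ : ∀ n {x y} → x ≤ y → n · x ≤ n · y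
  ·-monoʳ-≤ zero    x≤y = ≤-refl
  ·-monoʳ-≤ (suc n) x≤y = x≤y ⊕ ·-monoʳ-≤ n x≤y

  ·-cancel-< : ∀ {m n} → m · 1# < n · 1# → m ℕ.< n
  ·-cancel-< {m} {n} m<n = ℕ.≰⇒> λ n≤m → ≤⇒≯ (·-mono-≤ n≤m) m<n

  sum-mono : ∀ {n} {f g : Fin n → Carrier} → (∀ i → f i ≤ g i) → sum f ≤ sum g
  sum-mono {zero}  f≤g = ≤-refl
  sum-mono {suc n} f≤g = f≤g zero ⊕ sum-mono (f≤g ∘ suc)

-- Counting values below a threshold

module Counting (ℝ : RealNumbers) where
  open RealNumbers ℝ
  open OrderedField ℝ
  module ℕΣ = Algebra.Properties.CommutativeMonoid.Sum ℕ.+-0-commutativeMonoid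

  indicator : ∀ {P : Set} → Dec P → ℕ
  indicator (yes _) = 1
  indicator (no _)  = 0

  indicator-yes : ∀ {P : Set} (P? : Dec P) → P → indicator P? ≡ 1
  indicator-yes (yes _) _ = refl
  indicator-yes (no ¬p) p = contradiction p ¬p

  indicator-no : ∀ {P : Set} (P? : Dec P) → ¬ P → indicator P? ≡ 0
  indicator-no (yes p) ¬p = contradiction p ¬p
  indicator-no (no _)  _  = refl

  indicator-≤1 : ∀ {P : Set} (P? : Dec P) → indicator P? ℕ.≤ 1
  indicator-≤1 (yes _) = ℕ.≤-refl
  indicator-≤1 (no _)  = ℕ.z≤n

  indicator-mono : ∀ {P R : Set} (P? : Dec P) (R? : Dec R) → (P → R) → indicator P? ℕ.≤ indicator R?
  indicator-mono (yes p) R? f = ℕ.≤-reflexive (sym (indicator-yes R? (f p)))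
  indicator-mono (no _)  R? f = ℕ.z≤n

  indicator-≤ : ∀ {P : Set} (P? : Dec P) {w} → (P → 1# ≤ w) → 0# ≤ w → indicator P? · 1# ≤ w
  indicator-≤ (yes p) 1≤w 0≤w = ≤-trans (≡⇒≤ (+-identityʳ 1#)) (1≤w p)
  indicator-≤ (no _)  1≤w 0≤w = 0≤w

  count : ∀ {n} → (Fin n → Carrier) → Carrier → ℕ
  count f x = ℕΣ.sum (λ i → indicator (f i ≤? x))

  count≤n : ∀ {n} (f : Fin n → Carrier) x → count f x ℕ.≤ n
  count≤n {zero}  f x = ℕ.z≤n
  count≤n {suc n} f x = ℕ.+-mono-≤ (indicator-≤1 (f zero ≤? x)) (count≤n (f ∘ suc) x)

  count-all : ∀ {n} (f : Fin n → Carrier) x → (∀ i → f i ≤ x) → count f x ≡ n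
  count-all {zero}  f x f≤x = refl
  count-all {suc n} f x f≤x =
    cong₂ ℕ._+_ (indicator-yes (f zero ≤? x) (f≤x zero)) (count-all (f ∘ suc) x (f≤x ∘ suc))

  count-none : ∀ {n} (f : Fin n → Carrier) x → (∀ i → x < f i) → count f x ≡ 0
  count-none {zero}  f x x<f = refl
  count-none {suc n} f x x<f =
    cong₂ ℕ._+_ (indicator-no (f zero ≤? x) (λ f≤x → ≤⇒≯ f≤x (x<f zero)))
      (count-none (f ∘ suc) x (x<f ∘ suc))

  count≡n⇒all : ∀ {n} (f : Fin n → Carrier) x → n ℕ.≤ count f x → ∀ i → f i ≤ x
  count≡n⇒all {suc n} f x n≤ i with f zero ≤? x
  count≡n⇒all f x n≤ zero    | yes f₀≤x = f₀≤x
  count≡n⇒all f x n≤ (suc i) | yes _    = count≡n⇒all (f ∘ suc) x (ℕ.s≤s⁻¹ n≤) i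
  ... | no _ = contradiction n≤ (ℕ.<⇒≱ (ℕ.s≤s (count≤n (f ∘ suc) x)))

  count-antitone : ∀ {n} {f g : Fin n → Carrier} x → (∀ i → f i ≤ g i) → count g x ℕ.≤ count f x
  count-antitone {zero} x f≤g = ℕ.z≤n
  count-antitone {suc n} {f} {g} x f≤g = ℕ.+-mono-≤
    (indicator-mono (g zero ≤? x) (f zero ≤? x) (≤-trans (f≤g zero)))
    (count-antitone x (f≤g ∘ suc))

  count·1 : ∀ {n} (f : Fin n → Carrier) x →
            count f x · 1# ≡ sum (λ i → indicator (f i ≤? x) · 1#)
  count·1 {zero}  f x = refl
  count·1 {suc n} f x = trans (Mult.×-homo-+ 1# (indicator (f zero ≤? x)) (count (f ∘ suc) x))
    (cong (indicator (f zero ≤? x) · 1# +_) (count·1 (f ∘ suc) x))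

  argmin : ∀ {n} (f : Fin (suc n) → Carrier) → ∃ λ i → ∀ j → f i ≤ f j
  argmin {zero} f = zero , λ { zero → ≤-refl }
  argmin {suc n} f with argmin (f ∘ suc)
  ... | i , min with ≤-total (f zero) (f (suc i))
  ... | inj₁ f₀≤ = zero , λ { zero → ≤-refl ; (suc j) → ≤-trans f₀≤ (min j) }
  ... | inj₂ ≤f₀ = suc i , λ { zero → ≤f₀ ; (suc j) → min j }

  -- Sums are compared through order statistics without sorting. The counting
  -- hypothesis at x = min f shows that min g ≤ min f; below min f nothing of f is
  -- counted, and from there on both minima are, so the hypothesis survives the
  -- removal of the two minima.
  count-dominance : ∀ {n} (f g : Fin n → Carrier) →
                    (∀ x → count f x ℕ.≤ count g x) → sum g ≤ sum f
  count-dominance {zero}  f g dom = ≤-refl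
  count-dominance {suc n} f g dom with argmin f | argmin g
  ... | i , f-min | j , g-min = subst₂ _≤_
    (sym (Sum.sum-remove {i = j} g)) (sym (Sum.sum-remove {i = i} f))
    (g≤f ⊕ count-dominance (removeAt f i) (removeAt g j) dom′)
    where
    split : ∀ (h : Fin (suc n) → Carrier) k x →
            count h x ≡ indicator (h k ≤? x) ℕ.+ count (removeAt h k) x
    split h k x = ℕΣ.sum-remove {i = k} (λ l → indicator (h l ≤? x))

    g≤f : g j ≤ f i
    g≤f = ≮⇒≥ λ f<g → contradiction
      (ℕ.≤-trans (ℕ.≤-reflexive (sym (trans (split f i (f i))
          (cong (ℕ._+ count (removeAt f i) (f i)) (indicator-yes (f i ≤? f i) ≤-refl)))))
        (ℕ.≤-trans (dom (f i))
          (ℕ.≤-reflexive (count-none g (f i) (λ l → <-≤-trans f<g (g-min l))))))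
      λ ()

    dom′ : ∀ x → count (removeAt f i) x ℕ.≤ count (removeAt g j) x
    dom′ x with f i ≤? x
    ... | yes fi≤x = ℕ.s≤s⁻¹ (subst₂ ℕ._≤_
          (trans (split f i x) (cong (ℕ._+ count (removeAt f i) x) (indicator-yes (f i ≤? x) fi≤x)))
          (trans (split g j x) (cong (ℕ._+ count (removeAt g j) x) (indicator-yes (g j ≤? x) (≤-trans g≤f fi≤x))))
          (dom x))
    ... | no fi≰x = subst (ℕ._≤ _)
          (sym (count-none (removeAt f i) x (λ l → <-≤-trans (≰⇒> fi≰x) (f-min (punchIn i l))))) ℕ.z≤n

-- Additivity of measure

module Measure (ℝ : RealNumbers) (leb : LebesgueMeasure ℝ) where
  open RealNumbers ℝ
  open OrderedField ℝ
  open LebesgueMeasure leb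

  measure-empty : ∀ {A} (a : Measurable A) → (∀ {x} → ¬ A x) → measure a ≡ 0#
  measure-empty a ∅ = trans
    (measure-cong ((λ x → contradiction x ∅) , λ (0≤x , x<0) → contradiction x<0 (≤⇒≯ 0≤x)) a (interval 0# 0#))
    (trans (measure-interval ≤-refl) (-‿inverseʳ 0#))

  -- Membership in A has to be decidable: a point of B must be put into A or into
  -- the difference for the two to cover B.
  measure-split : ∀ {A B} → Decidable A → A ⊆ B → (a : Measurable A) (b : Measurable B) →
                  measure b ≡ measure a + measure (difference b a)
  measure-split A? A⊆B a b = trans
    (measure-cong
      ((λ {x} Bx → case-A (A? x) Bx) , λ { (inj₁ Ax) → A⊆B Ax ; (inj₂ (Bx , _)) → Bx })
      b (union a (difference b a)))
    (measure-union a (difference b a) λ (Ax , (_ , ¬Ax)) → ¬Ax Ax)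
    where
    case-A : ∀ {A B : Set} → Dec A → B → A ⊎ (B × ¬ A)
    case-A (yes a) b = inj₁ a
    case-A (no ¬a) b = inj₂ (b , ¬a)

  measure-mono : ∀ {A B} → Decidable A → A ⊆ B → (a : Measurable A) (b : Measurable B) →
                 measure a ≤ measure b
  measure-mono A? A⊆B a b = subst (measure a ≤_) (sym (measure-split A? A⊆B a b))
    (x≤x+y (measure-nonneg (difference b a)))

  measure-packing : ∀ {n} {A : Fin n → Pred Carrier _} {B} (a : ∀ i → Measurable (A i)) (b : Measurable B) →
                    (∀ i → Decidable (A i)) → (∀ i → A i ⊆ B) → (∀ {i j x} → A i x → A j x → i ≡ j) →
                    sum (λ i → measure (a i)) ≤ measure b
  measure-packing {zero} a b A? A⊆B disjoint = measure-nonneg b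
  measure-packing {suc n} {A} {B} a b A? A⊆B disjoint =
    subst (sum (λ i → measure (a i)) ≤_) (sym (measure-split (A? zero) (A⊆B zero) (a zero) b))
      (+-monoʳ-≤ (measure (a zero))
        (measure-packing (a ∘ suc) (difference b (a zero)) (A? ∘ suc)
          (λ i Ax → A⊆B (suc i) Ax , λ A₀x → contradiction (disjoint A₀x Ax) λ ())
          (λ Ax Ax′ → Fin.suc-injective (disjoint Ax Ax′))))

-- Work done by a schedule

module Workloads (ℝ : RealNumbers) where
  open RealNumbers ℝ

  -- The form in which `dominance` and `shorten` use the speed of the machine: the
  -- work g done up to time u, restricted to jobs released from time a on, fits into
  -- [a , u). The vector h selects the part of g to be counted, and jobs that are
  -- left out get a value that is at most zero. This form passes to any final
  -- segment of the jobs, as inductions over the pairs of jobs require.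
  Workload : ∀ {n} → (r g : Fin n → Carrier) → Carrier → Set
  Workload r g u = ∀ a h → 0# ≤ a → a ≤ u →
                   (∀ q → h q ≤ 0# ⊎ (a ≤ r q × h q ≤ g q)) → sum h + a ≤ u

module ScheduleFacts (ℝ : RealNumbers) (leb : LebesgueMeasure ℝ) where
  open RealNumbers ℝ
  open OrderedField ℝ
  open LebesgueMeasure leb
  open Measure ℝ leb
  open Workloads ℝ
  open Counting ℝ
  open SPPT ℝ leb

  module _ {Q : Input} (S : Schedule Q) where
    open Input Q
    open Schedule S hiding (flowTime)

    runsBefore? : ∀ q t → Decidable (RunsBefore q t)
    runsBefore? q t s = ((0# ≤? s) ×-dec (s <? t)) ×-dec Maybe.≡-dec Fin._≟_ (running s) (just q)

    runsBefore-⊆ : ∀ q {a u} → a ≤ u → RunsBefore q a ⊆ RunsBefore q u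
    runsBefore-⊆ q a≤u ((0≤s , s<a) , runs) = (0≤s , <-≤-trans s<a a≤u) , runs

    received-mono : ∀ q {a u} → a ≤ u → received q a ≤ received q u
    received-mono q {a} {u} a≤u = measure-mono (runsBefore? q a) (runsBefore-⊆ q a≤u) _ _

    received-unreleased : ∀ q {u} → u ≤ r q → received q u ≡ 0#
    received-unreleased q {u} u≤r = measure-empty (measurable q u)
      λ ((_ , s<u) , runs) → ≤⇒≯ (proj₁ (released-uncompleted runs)) (<-≤-trans s<u u≤r)

    completed⇒received : ∀ q {u} → completion q ≤ u → p q ≤ received q u
    completed⇒received q {u} c≤u = subst (_≤ received q u) (received-completion q) (received-mono q c≤u)

    received<p⇒uncompleted : ∀ q {u} → received q u < p q → u < completion q
    received<p⇒uncompleted q rec<p = ≰⇒> λ c≤u → ≤⇒≯ (completed⇒received q c≤u) rec<p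

    worked : JobId → Carrier → Carrier → Carrier
    worked q a u = measure (difference (measurable q u) (measurable q a))

    received-split : ∀ q {a u} → a ≤ u → received q u ≡ received q a + worked q a u
    received-split q {a} a≤u = measure-split (runsBefore? q a) (runsBefore-⊆ q a≤u) _ _

    worked-nonneg : ∀ q a u → 0# ≤ worked q a u
    worked-nonneg q a u = measure-nonneg _

    -- The machine runs one job at a time, so the time sets that the jobs occupy
    -- inside [a , u) are disjoint.
    capacity : ∀ {a u} → 0# ≤ a → a ≤ u → sum (λ q → worked q a u) + a ≤ u
    capacity {a} {u} 0≤a a≤u = ≤-from-sub (subst (sum (λ q → worked q a u) ≤_) (measure-interval a≤u)
      (measure-packing (λ q → difference (measurable q u) (measurable q a)) (interval a u)
        (λ q s → runsBefore? q u s ×-dec ¬? (runsBefore? q a s))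
        (λ q (((0≤s , s<u) , runs) , ¬before) →
          ≮⇒≥ (λ s<a → ¬before ((0≤s , s<a) , runs)) , s<u)
        (λ ((_ , runs) , _) ((_ , runs′) , _) → Maybe.just-injective (trans (sym runs) runs′))))

    workload : ∀ u → Workload r (λ q → received q u) u
    workload u a h 0≤a a≤u h≤ =
      ≤-trans (+-monoˡ-≤ a (sum-mono h≤worked)) (capacity 0≤a a≤u)
      where
      h≤worked : ∀ q → h q ≤ worked q a u
      h≤worked q with h≤ q
      ... | inj₁ h≤0          = ≤-trans h≤0 (worked-nonneg q a u)
      ... | inj₂ (a≤r , h≤g) = ≤-trans h≤g (≡⇒≤ (trans (received-split q a≤u)
        (trans (cong (_+ worked q a u) (received-unreleased q a≤r)) (+-identityˡ (worked q a u)))))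

    release≤completion : ∀ q → r q ≤ completion q
    release≤completion q = ≮⇒≥ λ c<r → <-irrefl
      (trans (sym (received-unreleased q (<⇒≤ c<r))) (received-completion q))
      (Job.processing-pos (job q))

    -- When every job, released or not, still needs a unit of work at time T, a
    -- machine of unit rate completes at most one job per unit of time from then on,
    -- however small the sizes of new jobs are compared with the old ones.
    completion-rate : ∀ {T} → 0# ≤ T → (∀ q → received q T + 1# ≤ p q) →
                      ∀ x → count completion x ≡ 0 ⊎ count completion x · 1# + T ≤ x
    completion-rate {T} 0≤T remaining x = cases (T ≤? x)
      where
      open-until-T : ∀ q → T < completion q
      open-until-T q = received<p⇒uncompleted q (<-≤-trans (x<x+y 0<1) (remaining q))

      unit-of-work : ∀ q → T ≤ x → completion q ≤ x → 1# ≤ worked q T x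
      unit-of-work q T≤x c≤x = linear-≤
        (remaining q ⊕ ≤-trans (completed⇒received q c≤x) (≡⇒≤ (received-split q T≤x)))
        (solve 3 (λ p g w → con 1 :+ (p :+ (g :+ w)) := w :+ ((g :+ con 1) :+ p)) refl
          (p q) (received q T) (worked q T x))

      cases : Dec (T ≤ x) → count completion x ≡ 0 ⊎ count completion x · 1# + T ≤ x
      cases (no T≰x) = inj₁ (count-none completion x λ q → <-trans (≰⇒> T≰x) (open-until-T q))
      cases (yes T≤x) = inj₂ (≤-trans
        (+-monoˡ-≤ T (≤-trans (≡⇒≤ (count·1 completion x))
          (sum-mono λ q → indicator-≤ (completion q ≤? x) (unit-of-work q T≤x) (worked-nonneg q T x))))
        (capacity 0≤T T≤x))

-- Schedules without preemption

module SlotSchedule (ℝ : RealNumbers) (leb : LebesgueMeasure ℝ) where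
  open RealNumbers ℝ
  open OrderedField ℝ
  open LebesgueMeasure leb
  open SPPT ℝ leb

  module _ (Q : Input) (start : Input.JobId Q → Carrier)
    (released : ∀ q → Input.r Q q ≤ start q)
    (disjoint : ∀ q q′ {x} → [ start q , start q + Input.p Q q ⟩ x →
                [ start q′ , start q′ + Input.p Q q′ ⟩ x → q ≡ q′) where
    open Input Q

    private
      stop : JobId → Carrier
      stop q = start q + p q

      Slot : JobId → Pred Carrier _
      Slot q = [ start q , stop q ⟩

      search : ∀ {x} → Dec (∃ λ q → Slot q x) → Maybe JobId
      search (yes (q , _)) = just q
      search (no _)        = nothing

      inSlot? : ∀ x → Dec (∃ λ q → Slot q x)
      inSlot? x = any? λ q → (start q ≤? x) ×-dec (x <? stop q)

      runs : Carrier → Maybe JobId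
      runs x = search (inSlot? x)

      runs⇒slot : ∀ {q x} → runs x ≡ just q → Slot q x
      runs⇒slot {q} {x} eq with inSlot? x
      runs⇒slot refl | yes (_ , slot) = slot

      slot⇒runs : ∀ {q x} → Slot q x → runs x ≡ just q
      slot⇒runs {q} {x} slot with inSlot? x
      ... | yes (q′ , slot′) = cong just (disjoint q′ q slot′ slot)
      ... | no none          = contradiction (q , slot) none

      start-nonneg : ∀ q → 0# ≤ start q
      start-nonneg q = ≤-trans (Job.release-nonneg (job q)) (released q)

      start<stop : ∀ q → start q < stop q
      start<stop q = x<x+y (Job.processing-pos (job q))

      RunsBefore : JobId → Carrier → Pred Carrier _
      RunsBefore q t s = [ 0# , t ⟩ s × runs s ≡ just q

      -- The part of a slot that lies before time t is again an interval, whose length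
      -- is the work received; it is empty when t precedes the slot.
      record Elapsed (q : JobId) (t : Carrier) : Set where
        field
          end       : Carrier
          start≤end : start q ≤ end
          elapsed   : [ start q , end ⟩ ≐ RunsBefore q t
          complete  : stop q ≤ t → end ≡ stop q
          partial   : t < stop q → end < stop q

      elapsed : ∀ q t → Elapsed q t
      elapsed q t with t ≤? start q
      ... | yes t≤start = record
        { end       = start q
        ; start≤end = ≤-refl
        ; elapsed   = (λ (s≤x , x<s) → contradiction x<s (≤⇒≯ s≤x))
                    , λ ((_ , x<t) , eq) → contradiction
                        (<-≤-trans x<t t≤start) (≤⇒≯ (proj₁ (runs⇒slot eq)))
        ; complete  = λ f≤t → contradiction (start<stop q) (≤⇒≯ (≤-trans f≤t t≤start))
        ; partial   = λ _ → start<stop q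
        }
      ... | no t≰start with t <? stop q
      ... | yes t<stop = record
        { end       = t
        ; start≤end = <⇒≤ (≰⇒> t≰start)
        ; elapsed   = (λ (s≤x , x<t) → (≤-trans (start-nonneg q) s≤x , x<t)
                                     , slot⇒runs (s≤x , <-trans x<t t<stop))
                    , λ ((_ , x<t) , eq) → proj₁ (runs⇒slot eq) , x<t
        ; complete  = λ f≤t → contradiction t<stop (≤⇒≯ f≤t)
        ; partial   = λ t<f → t<f
        }
      ... | no t≮stop = record
        { end       = stop q
        ; start≤end = <⇒≤ (start<stop q)
        ; elapsed   = (λ (s≤x , x<f) → (≤-trans (start-nonneg q) s≤x , <-≤-trans x<f (≮⇒≥ t≮stop))
                                     , slot⇒runs (s≤x , x<f))
                    , λ (_ , eq) → runs⇒slot eq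
        ; complete  = λ _ → refl
        ; partial   = λ t<f → contradiction t<f t≮stop
        }

      measurable : ∀ q t → Measurable (RunsBefore q t)
      measurable q t = resp-≐ (Elapsed.elapsed (elapsed q t)) (interval (start q) _)

      received≡ : ∀ q t → measure (measurable q t) ≡ Elapsed.end (elapsed q t) - start q
      received≡ q t = trans (sym (measure-cong (Elapsed.elapsed (elapsed q t)) (interval _ _) _))
        (measure-interval (Elapsed.start≤end (elapsed q t)))

      stop-start : ∀ q → stop q - start q ≡ p q
      stop-start q = trans (cong (_- start q) (+-comm (start q) (p q))) (+--cancel (p q) (start q))

    slotSchedule : Schedule Q
    slotSchedule = record
      { running               = runs
      ; measurable            = measurable
      ; completion            = stop
      ; received-completion   = λ q → trans (received≡ q (stop q))
          (trans (cong (_- start q) (Elapsed.complete (elapsed q (stop q)) ≤-refl)) (stop-start q))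
      ; received-<-completion = λ q t t<f → subst₂ _<_ (sym (received≡ q t)) (stop-start q)
          (+-monoˡ-< (- start q) (Elapsed.partial (elapsed q t) t<f))
      ; released-uncompleted  = λ {q} eq →
          ≤-trans (released q) (proj₁ (runs⇒slot eq)) , proj₂ (runs⇒slot eq)
      }

-- Inputs an online algorithm cannot tell apart

module Adaptivity (ℝ : RealNumbers) (leb : LebesgueMeasure ℝ) where
  open RealNumbers ℝ
  open OrderedField ℝ
  open Counting ℝ using (argmin)
  open LebesgueMeasure leb
  open SPPT ℝ leb
  open ScheduleFacts ℝ leb

  module HiddenSizes {n : ℕ} (release predicted : Fin n → Carrier)
    (release-nonneg : ∀ q → 0# ≤ release q)
    (predicted-pos : ∀ q → 0# < predicted q)
    (sorted : ∀ {i j} → i Fin.≤ j → release i ≤ release j) where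

    withSizes : (p : Fin n → Carrier) → (∀ q → 0# < p q) → Input
    withSizes p p-pos = record
      { size   = n
      ; job    = λ q → record
        { processing     = p q
        ; release        = release q
        ; predicted      = predicted q
        ; processing-pos = p-pos q
        ; release-nonneg = release-nonneg q
        ; predicted-pos  = predicted-pos q
        }
      ; sorted = sorted
      }

    module _ (ALG : OnlineAlgorithm) where
      open OnlineAlgorithm ALG

      module _ {p p′ : Fin n → Carrier} (p-pos : ∀ q → 0# < p q) (p′-pos : ∀ q → 0# < p′ q) where
        private
          Q  = withSizes p p-pos
          Q′ = withSizes p′ p′-pos
          module S  = Schedule (schedule Q)
          module S′ = Schedule (schedule Q′)

        same-received : ∀ u → (∀ q {s} → s < u → s < S.completion q) →
                        (∀ q {s} → s < u → s < S′.completion q) →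
                        ∀ q → S.received q u ≡ S′.received q u
        same-received u open-S open-S′ q = measure-cong
            ((λ { ((0≤s , s<u) , runs) → (0≤s , s<u) , trans (sym (same-running s<u)) runs })
            , λ { ((0≤s , s<u) , runs) → (0≤s , s<u) , trans (same-running s<u) runs })
            _ _
          where
          same-running : ∀ {s} → s < u → S.running s ≡ S′.running s
          same-running {s} s<u = Maybe.map-injective Fin.toℕ-injective
            (nonanticipative Q Q′ s
              ( (λ { (arrived q r≤s)  → arrived q r≤s
                   ; (finished q c≤s) → contradiction (open-S q s<u) (≤⇒≯ c≤s) })
              , (λ { (arrived q r≤s)  → arrived q r≤s
                   ; (finished q c≤s) → contradiction (open-S′ q s<u) (≤⇒≯ c≤s) })))

        -- Two inputs with the same releases and predictions differ only in what
        -- completions reveal. Suppose that, run on the first input, the algorithm has by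
        -- time T given each job less than its size in either input. If the first
        -- completion on the second input happened by T, both runs would have agreed so
        -- far, and the completed job would have received less than its size. So the runs
        -- agree up to T.
        indistinguishable : ∀ T → (∀ q → S.received q T < p q) → (∀ q → S.received q T < p′ q) →
                            ∀ q → S′.received q T ≡ S.received q T
        indistinguishable T rec<p rec<p′ q =
          sym (same-received T (λ q s<T → <-trans s<T (open-S q)) (λ q s<T → <-trans s<T (open-S′ q)) q)
          where
          open-S : ∀ q → T < S.completion q
          open-S q = received<p⇒uncompleted (schedule Q) q (rec<p q)

          first-not-by-T : ∀ q → (∀ q′ → S′.completion q ≤ S′.completion q′) → T < S′.completion q
          first-not-by-T q first = ≰⇒> λ c≤T → <-irrefl
            (trans (same-received (S′.completion q)
                     (λ q′ s<c → <-trans (<-≤-trans s<c c≤T) (open-S q′))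
                     (λ q′ s<c → <-≤-trans s<c (first q′)) q)
                   (S′.received-completion q))
            (≤-<-trans (received-mono (schedule Q) q c≤T) (rec<p′ q))

          open-S′ : ∀ q → T < S′.completion q
          open-S′ = by-first S′.completion first-not-by-T
            where
            by-first : ∀ {n} (c : Fin n → Carrier) →
                       (∀ q → (∀ q′ → c q ≤ c q′) → T < c q) → ∀ q → T < c q
            by-first {suc n} c first q with argmin c
            ... | i , min = <-≤-trans (first i min) (min q)

-- The scales of the adversary

-- A long job exceeds its prediction by the fraction κ.
record Stretch (ℝ : RealNumbers) (μ : RealNumbers.Carrier ℝ) : Set where
  open RealNumbers ℝ
  field
    κ     : Carrier
    0<κ   : 0# < κ
    2κ≤1  : κ + κ ≤ 1#
    1+κ<μ : 1# + κ < μ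

module Scales (ℝ : RealNumbers) {μ : RealNumbers.Carrier ℝ} (K : Stretch ℝ μ) where
  open RealNumbers ℝ
  open OrderedField ℝ
  open Stretch K

  -- The flag tells long jobs from short ones, and x is the prediction.
  size : Bool → Carrier → Carrier
  size true  x = x + κ * x
  size false x = x

  span : ∀ {k} → Vec Carrier k → Carrier
  span []       = 0#
  span (s ∷ ss) = s + span ss

  pairWork : ∀ {k} → Vec Carrier k → Carrier
  pairWork []       = 0#
  pairWork (s ∷ ss) = s + (s + κ * s) + pairWork ss

  -- The slack κ s of a long job covers all the work in later pairs and one unit
  -- besides. While these later pairs arrive, the long job of a pair cannot be
  -- completed, and the smaller of the two received amounts stays below s.
  Spaced : ∀ {k} → Vec Carrier k → Set
  Spaced []       = ⊤
  Spaced (s ∷ ss) = 0# < s × pairWork ss + 1# ≤ κ * s × Spaced ss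

  κ-scale : ∀ {s} → 0# ≤ s → κ * s + κ * s ≤ s
  κ-scale {s} 0≤s = subst₂ _≤_
    (trans (*-comm s (κ + κ)) (distribʳ s κ κ)) (*-identityʳ s) (*-monoʳ-≤ 0≤s 2κ≤1)

  κs-nonneg : ∀ {s} → 0# ≤ s → 0# ≤ κ * s
  κs-nonneg = *-nonneg (<⇒≤ 0<κ)

  size-≥ : ∀ b {x} → 0# ≤ x → x ≤ size b x
  size-≥ true  0≤x = x≤x+y (κs-nonneg 0≤x)
  size-≥ false 0≤x = ≤-refl

  size-≤ : ∀ b {x} → 0# ≤ x → size b x ≤ size true x
  size-≤ true  0≤x = ≤-refl
  size-≤ false 0≤x = x≤x+y (κs-nonneg 0≤x)

  pairWork-nonneg : ∀ {k} (ss : Vec Carrier k) → Spaced ss → 0# ≤ pairWork ss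
  pairWork-nonneg []       _ = ≤-refl
  pairWork-nonneg (s ∷ ss) (0<s , _ , sp) =
    +-nonneg (+-nonneg 0≤s (+-nonneg 0≤s (κs-nonneg 0≤s))) (pairWork-nonneg ss sp)
    where 0≤s = <⇒≤ 0<s

  span-nonneg : ∀ {k} (ss : Vec Carrier k) → Spaced ss → 0# ≤ span ss
  span-nonneg []       _              = ≤-refl
  span-nonneg (s ∷ ss) (0<s , _ , sp) = +-nonneg (<⇒≤ 0<s) (span-nonneg ss sp)

  span≤pairWork : ∀ {k} (ss : Vec Carrier k) → Spaced ss → span ss ≤ pairWork ss
  span≤pairWork []       _ = ≤-refl
  span≤pairWork (s ∷ ss) (0<s , _ , sp) =
    x≤x+y (+-nonneg (<⇒≤ 0<s) (κs-nonneg (<⇒≤ 0<s))) ⊕ span≤pairWork ss sp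

  -- This is where κ ≤ 1/2 enters: two slacks fit into s.
  gap : ∀ {k s} (ss : Vec Carrier k) → Spaced (s ∷ ss) → (pairWork ss + 1#) + (pairWork ss + 1#) ≤ s
  gap ss (0<s , g , _) = ≤-trans (g ⊕ g) (κ-scale (<⇒≤ 0<s))

  1≤s : ∀ {k s} (ss : Vec Carrier k) → Spaced (s ∷ ss) → 1# ≤ s
  1≤s {s = s} ss sp@(_ , _ , sp′) =
    linear-≤ (pairWork-nonneg ss sp′ ⊕ pairWork-nonneg ss sp′ ⊕ <⇒≤ 0<1 ⊕ gap ss sp)
      (solve 2 (λ b s → con 1 :+ (b :+ (b :+ (con 1 :+ s)))
                   := s :+ (con 0 :+ (con 0 :+ (con 0 :+ ((b :+ con 1) :+ (b :+ con 1))))))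
        refl (pairWork ss) s)

  spaced : ∀ k → ∃ λ (ss : Vec Carrier k) → Spaced ss
  spaced zero = [] , tt
  spaced (suc k) with spaced k | positiveInverse 0<κ
  ... | ss , sp | κ⁻¹ , 0<κ⁻¹ , κκ⁻¹≡1 =
    s ∷ ss , *-pos 0<κ⁻¹ 0<x , ≡⇒≤ (sym κs≡x) , sp
    where
    x = pairWork ss + 1#
    s = κ⁻¹ * x
    0<x : 0# < x
    0<x = subst (0# <_) (+-comm 1# (pairWork ss)) (+-pos-nonneg 0<1 (pairWork-nonneg ss sp))
    κs≡x : κ * s ≡ x
    κs≡x = trans (sym (*-assoc κ κ⁻¹ x)) (trans (cong (_* x) κκ⁻¹≡1) (*-identityˡ x))

-- The adversary's jobs and their optimal schedule

module Cascade (ℝ : RealNumbers) {μ : RealNumbers.Carrier ℝ} (K : Stretch ℝ μ) (m : ℕ) where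
  open RealNumbers ℝ
  open OrderedField ℝ
  open Stretch K
  open Workloads ℝ
  open Scales ℝ K
  open Counting ℝ

  jobCount : ℕ → ℕ
  jobCount zero    = m
  jobCount (suc k) = suc (suc (jobCount k))

  unitRelease : ∀ n → Carrier → Fin n → Carrier
  unitRelease (suc n) t zero    = t
  unitRelease (suc n) t (suc i) = unitRelease n (t + 1#) i

  release : ∀ {k} → Vec Carrier k → Carrier → Fin (jobCount k) → Carrier
  release []       t i             = unitRelease m t i
  release (s ∷ ss) t zero          = t
  release (s ∷ ss) t (suc zero)    = t
  release (s ∷ ss) t (suc (suc q)) = release ss (t + s) q

  predicted : ∀ {k} → Vec Carrier k → Fin (jobCount k) → Carrier
  predicted []       i             = 1#
  predicted (s ∷ ss) zero          = s
  predicted (s ∷ ss) (suc zero)    = s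
  predicted (s ∷ ss) (suc (suc q)) = predicted ss q

  isLong : ∀ {k} → Vec Bool k → Fin (jobCount k) → Bool
  isLong []       i             = false
  isLong (b ∷ bs) zero          = b
  isLong (b ∷ bs) (suc zero)    = not b
  isLong (b ∷ bs) (suc (suc q)) = isLong bs q

  actual : ∀ {k} → Vec Carrier k → Vec Bool k → Fin (jobCount k) → Carrier
  actual ss bs q = size (isLong bs q) (predicted ss q)

  totalWork : ∀ {k} → Vec Carrier k → Carrier
  totalWork ss = pairWork ss + m · 1#

  -- The optimal schedule runs the short job of a pair at once and the long job
  -- last; between them it runs all later jobs by the same rule.
  pairStart : ∀ {k} → Carrier → Vec Carrier k → Carrier → Bool → Carrier
  pairStart s ss t true  = t + s + totalWork ss
  pairStart s ss t false = t

  start : ∀ {k} → Vec Carrier k → Vec Bool k → Carrier → Fin (jobCount k) → Carrier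
  start []       []       t i             = unitRelease m t i
  start (s ∷ ss) (b ∷ bs) t zero          = pairStart s ss t b
  start (s ∷ ss) (b ∷ bs) t (suc zero)    = pairStart s ss t (not b)
  start (s ∷ ss) (b ∷ bs) t (suc (suc q)) = start ss bs (t + s) q

  stop : ∀ {k} → Vec Carrier k → Vec Bool k → Carrier → Fin (jobCount k) → Carrier
  stop ss bs t q = start ss bs t q + actual ss bs q

  -- Reference completion times: one unit job per unit of time from T on, and all
  -- pairs together with the last unit job. In the order of completion, they bound
  -- the completions of the algorithm from below when T is the time at which the
  -- unit jobs start to arrive. They bound those of the optimal schedule from above
  -- when T is the initial time plus the work of all pairs.
  lateStop : ∀ k → Carrier → Fin (jobCount k) → Carrier
  lateStop zero    T i             = unitRelease m T i + 1#
  lateStop (suc k) T zero          = T + m · 1#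
  lateStop (suc k) T (suc zero)    = T + m · 1#
  lateStop (suc k) T (suc (suc q)) = lateStop k T q

  0≤m : 0# ≤ m · 1#
  0≤m = ·-nonneg m

  totalWork-nonneg : ∀ {k} (ss : Vec Carrier k) → Spaced ss → 0# ≤ totalWork ss
  totalWork-nonneg ss sp = +-nonneg (pairWork-nonneg ss sp) 0≤m

  predicted≥1 : ∀ {k} (ss : Vec Carrier k) → Spaced ss → ∀ q → 1# ≤ predicted ss q
  predicted≥1 []       sp i             = ≤-refl
  predicted≥1 (s ∷ ss) sp zero          = 1≤s ss sp
  predicted≥1 (s ∷ ss) sp (suc zero)    = 1≤s ss sp
  predicted≥1 (s ∷ ss) (_ , _ , sp) (suc (suc q)) = predicted≥1 ss sp q

  predicted-pos : ∀ {k} (ss : Vec Carrier k) → Spaced ss → ∀ q → 0# < predicted ss q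
  predicted-pos ss sp q = <-≤-trans 0<1 (predicted≥1 ss sp q)

  actual≥1 : ∀ {k} (ss : Vec Carrier k) bs → Spaced ss → ∀ q → 1# ≤ actual ss bs q
  actual≥1 ss bs sp q = ≤-trans (predicted≥1 ss sp q)
    (size-≥ (isLong bs q) (<⇒≤ (predicted-pos ss sp q)))

  units-≥ : ∀ n t i → t ≤ unitRelease n t i
  units-≥ (suc n) t zero    = ≤-refl
  units-≥ (suc n) t (suc i) = ≤-trans (x≤x+y (<⇒≤ 0<1)) (units-≥ n (t + 1#) i)

  units-≤ : ∀ n t i → unitRelease n t i + 1# ≤ t + n · 1#
  units-≤ (suc n) t zero    = +-monoʳ-≤ t (x≤x+y (·-nonneg n))
  units-≤ (suc n) t (suc i) = subst (unitRelease n (t + 1#) i + 1# ≤_)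
    (+-assoc t 1# (n · 1#)) (units-≤ n (t + 1#) i)

  units-sorted : ∀ n t {i j} → i Fin.≤ j → unitRelease n t i ≤ unitRelease n t j
  units-sorted (suc n) t {zero}  {j}     _         = units-≥ (suc n) t j
  units-sorted (suc n) t {suc i} {suc j} (ℕ.s≤s l) = units-sorted n (t + 1#) l

  units-mono : ∀ n {t u} → t ≤ u → ∀ i → unitRelease n t i ≤ unitRelease n u i
  units-mono (suc n) t≤u zero    = t≤u
  units-mono (suc n) t≤u (suc i) = units-mono n (+-monoˡ-≤ 1# t≤u) i

  units-disjoint : ∀ n t i j {x} → [ unitRelease n t i , unitRelease n t i + 1# ⟩ x →
                   [ unitRelease n t j , unitRelease n t j + 1# ⟩ x → i ≡ j
  units-disjoint (suc n) t zero    zero    _ _ = refl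
  units-disjoint (suc n) t zero    (suc j) (_ , x<) (≤x , _) =
    contradiction x< (≤⇒≯ (≤-trans (units-≥ n (t + 1#) j) ≤x))
  units-disjoint (suc n) t (suc i) zero    (≤x , _) (_ , x<) =
    contradiction x< (≤⇒≯ (≤-trans (units-≥ n (t + 1#) i) ≤x))
  units-disjoint (suc n) t (suc i) (suc j) I J = cong suc (units-disjoint n (t + 1#) i j I J)

  -- The c-th unit job is completed at t + c.
  units-count : ∀ n t x c → c ℕ.≤ n → c · 1# + t ≤ x → c ℕ.≤ count (λ i → unitRelease n t i + 1#) x
  units-count n       t x zero    _           _ = ℕ.z≤n
  units-count (suc n) t x (suc c) (ℕ.s≤s c≤n) h
    rewrite indicator-yes (t + 1# ≤? x)
      (linear-≤ (h ⊕ ·-nonneg c)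
        (solve 3 (λ t x c → (t :+ con 1) :+ (x :+ c) := x :+ (((con 1 :+ c) :+ t) :+ con 0)) refl t x (c · 1#)))
    = ℕ.s≤s (units-count n (t + 1#) x c c≤n
        (subst (_≤ x) (solve 2 (λ t c → (con 1 :+ c) :+ t := c :+ (t :+ con 1)) refl t (c · 1#)) h))

  release-≥ : ∀ {k} (ss : Vec Carrier k) → Spaced ss → ∀ t q → t ≤ release ss t q
  release-≥ []       _  t i          = units-≥ m t i
  release-≥ (s ∷ ss) _  t zero       = ≤-refl
  release-≥ (s ∷ ss) _  t (suc zero) = ≤-refl
  release-≥ (s ∷ ss) (0<s , _ , sp) t (suc (suc q)) =
    ≤-trans (x≤x+y (<⇒≤ 0<s)) (release-≥ ss sp (t + s) q)

  release-sorted : ∀ {k} (ss : Vec Carrier k) → Spaced ss → ∀ t {i j} → i Fin.≤ j →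
                   release ss t i ≤ release ss t j
  release-sorted []       _  t i≤j = units-sorted m t i≤j
  release-sorted (s ∷ ss) sp t {zero}     {j} _ = release-≥ (s ∷ ss) sp t j
  release-sorted (s ∷ ss) sp t {suc zero} {j} _ = release-≥ (s ∷ ss) sp t j
  release-sorted (s ∷ ss) sp t {suc (suc i)} {suc zero} (ℕ.s≤s ())
  release-sorted (s ∷ ss) (_ , _ , sp) t {suc (suc i)} {suc (suc j)} (ℕ.s≤s (ℕ.s≤s i≤j)) =
    release-sorted ss sp (t + s) i≤j

  pair-released : ∀ {k s} (ss : Vec Carrier k) → Spaced (s ∷ ss) → ∀ t b → t ≤ pairStart s ss t b
  pair-released ss (0<s , _ , sp) t true  = ≤-trans (x≤x+y (<⇒≤ 0<s)) (x≤x+y (totalWork-nonneg ss sp))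
  pair-released ss sp             t false = ≤-refl

  released : ∀ {k} (ss : Vec Carrier k) bs → Spaced ss → ∀ t q → release ss t q ≤ start ss bs t q
  released []       []       _  t i          = ≤-refl
  released (s ∷ ss) (b ∷ bs) sp t zero       = pair-released ss sp t b
  released (s ∷ ss) (b ∷ bs) sp t (suc zero) = pair-released ss sp t (not b)
  released (s ∷ ss) (b ∷ bs) (_ , _ , sp) t (suc (suc q)) = released ss bs sp (t + s) q

  lateStop-mono : ∀ k {t u} → t ≤ u → ∀ q → lateStop k t q ≤ lateStop k u q
  lateStop-mono zero    t≤u i             = +-monoˡ-≤ 1# (units-mono m t≤u i)
  lateStop-mono (suc k) t≤u zero          = +-monoˡ-≤ (m · 1#) t≤u
  lateStop-mono (suc k) t≤u (suc zero)    = +-monoˡ-≤ (m · 1#) t≤u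
  lateStop-mono (suc k) t≤u (suc (suc q)) = lateStop-mono k t≤u q

  lateStop-≤ : ∀ k t q → lateStop k t q ≤ t + m · 1#
  lateStop-≤ zero    t i             = units-≤ m t i
  lateStop-≤ (suc k) t zero          = ≤-refl
  lateStop-≤ (suc k) t (suc zero)    = ≤-refl
  lateStop-≤ (suc k) t (suc (suc q)) = lateStop-≤ k t q

  short-stop≤ : ∀ {k s} (ss : Vec Carrier k) → Spaced (s ∷ ss) → ∀ t →
                t + s ≤ (t + pairWork (s ∷ ss)) + m · 1#
  short-stop≤ {s = s} ss (0<s , _ , sp) t =
    linear-≤ (<⇒≤ 0<s ⊕ κs-nonneg (<⇒≤ 0<s) ⊕ pairWork-nonneg ss sp ⊕ 0≤m)
      (solve 5 (λ t s κs b M → (t :+ s) :+ (s :+ (κs :+ (b :+ M)))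
          := ((t :+ (s :+ (s :+ κs) :+ b)) :+ M) :+ (con 0 :+ (con 0 :+ (con 0 :+ con 0))))
        refl t s (κ * s) (pairWork ss) (m · 1#))

  long-stop≡ : ∀ {k} s (ss : Vec Carrier k) t →
               (t + s + totalWork ss) + (s + κ * s) ≡ (t + pairWork (s ∷ ss)) + m · 1#
  long-stop≡ s ss t = solve 5 (λ t s κs b M → (t :+ s :+ (b :+ M)) :+ (s :+ κs)
      := (t :+ (s :+ (s :+ κs) :+ b)) :+ M) refl t s (κ * s) (pairWork ss) (m · 1#)

  rest-pairWork≤ : ∀ {k s} (ss : Vec Carrier k) → Spaced (s ∷ ss) → ∀ t →
              (t + s) + pairWork ss ≤ t + pairWork (s ∷ ss)
  rest-pairWork≤ {s = s} ss (0<s , _ , sp) t =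
    linear-≤ (+-nonneg (<⇒≤ 0<s) (κs-nonneg (<⇒≤ 0<s)))
      (solve 4 (λ t s κs b → ((t :+ s) :+ b) :+ (s :+ κs) := (t :+ (s :+ (s :+ κs) :+ b)) :+ con 0)
        refl t s (κ * s) (pairWork ss))

  pair-stop≤ : ∀ {k s} (ss : Vec Carrier k) → Spaced (s ∷ ss) → ∀ t b →
               pairStart s ss t b + size b s ≤ (t + pairWork (s ∷ ss)) + m · 1#
  pair-stop≤ {s = s} ss sp t true  = ≡⇒≤ (long-stop≡ s ss t)
  pair-stop≤         ss sp t false = short-stop≤ ss sp t

  stop≤lateStop : ∀ {k} (ss : Vec Carrier k) bs → Spaced ss → ∀ t q →
              stop ss bs t q ≤ lateStop k (t + pairWork ss) q
  stop≤lateStop []       []       _  t i          = +-monoˡ-≤ 1# (units-mono m (≡⇒≤ (sym (+-identityʳ t))) i)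
  stop≤lateStop (s ∷ ss) (b ∷ bs) sp t zero       = pair-stop≤ ss sp t b
  stop≤lateStop (s ∷ ss) (b ∷ bs) sp t (suc zero) = pair-stop≤ ss sp t (not b)
  stop≤lateStop (s ∷ ss) (b ∷ bs) sp t (suc (suc q)) =
    ≤-trans (stop≤lateStop ss bs (proj₂ (proj₂ sp)) (t + s) q) (lateStop-mono _ (rest-pairWork≤ ss sp t) q)

  stop≤totalWork : ∀ {k} (ss : Vec Carrier k) bs → Spaced ss → ∀ t q → stop ss bs t q ≤ t + totalWork ss
  stop≤totalWork {k} ss bs sp t q = ≤-trans (stop≤lateStop ss bs sp t q)
    (≤-trans (lateStop-≤ k (t + pairWork ss) q) (≡⇒≤ (+-assoc t (pairWork ss) (m · 1#))))

  -- Before T + m fewer than m jobs are counted, so the unit jobs suffice; from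
  -- T + m on every job is counted.
  lateStop-count : ∀ k T x c → c ℕ.≤ jobCount k → c · 1# + T ≤ x → c ℕ.≤ count (lateStop k T) x
  lateStop-count zero    T x c c≤N h = units-count m T x c c≤N h
  lateStop-count (suc k) T x c c≤N h with T + m · 1# ≤? x
  ... | yes all  = subst (c ℕ.≤_)
    (sym (cong (2 ℕ.+_) (count-all (lateStop k T) x (λ q → ≤-trans (lateStop-≤ k T q) all)))) c≤N
  ... | no  some = lateStop-count k T x c (ℕ.≤-trans (ℕ.<⇒≤ c<m) (m≤jobCount k)) h
    where
    m≤jobCount : ∀ k → m ℕ.≤ jobCount k
    m≤jobCount zero    = ℕ.≤-refl
    m≤jobCount (suc k) = ℕ.m≤n⇒m≤1+n (ℕ.m≤n⇒m≤1+n (m≤jobCount k))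

    c<m : c ℕ.< m
    c<m = ·-cancel-< (+-cancelʳ-< (subst (c · 1# + T <_) (+-comm T (m · 1#))
      (≤-<-trans h (≰⇒> some))))

  start-≥ : ∀ {k} (ss : Vec Carrier k) bs → Spaced ss → ∀ t q → t ≤ start ss bs t q
  start-≥ ss bs sp t q = ≤-trans (release-≥ ss sp t q) (released ss bs sp t q)

  apart : ∀ {a b c d x} {A : Set} → b ≤ c → [ a , b ⟩ x → [ c , d ⟩ x → A
  apart b≤c (_ , x<b) (c≤x , _) = contradiction x<b (≤⇒≯ (≤-trans b≤c c≤x))

  disjoint : ∀ {k} (ss : Vec Carrier k) bs → Spaced ss → ∀ t q q′ {x} →
             [ start ss bs t q , stop ss bs t q ⟩ x →
             [ start ss bs t q′ , stop ss bs t q′ ⟩ x → q ≡ q′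
  disjoint []       []       _  t i j = units-disjoint m t i j
  disjoint (s ∷ ss) (b ∷ bs) sp@(0<s , _ , sp′) t = cases
    where
    short≤long : t + s ≤ t + s + totalWork ss
    short≤long = x≤x+y (totalWork-nonneg ss sp′)

    pair-rest : ∀ {A : Set} b q {x} → [ pairStart s ss t b , pairStart s ss t b + size b s ⟩ x →
                [ start ss bs (t + s) q , stop ss bs (t + s) q ⟩ x → A
    pair-rest true  q I J = apart (stop≤totalWork ss bs sp′ (t + s) q) J I
    pair-rest false q I J = apart (start-≥ ss bs sp′ (t + s) q) I J

    pair-pair : ∀ {A : Set} b {x} → [ pairStart s ss t b , pairStart s ss t b + size b s ⟩ x →
                [ pairStart s ss t (not b) , pairStart s ss t (not b) + size (not b) s ⟩ x → A
    pair-pair true  I J = apart short≤long J I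
    pair-pair false I J = apart short≤long I J

    cases : ∀ q q′ {x} → [ start (s ∷ ss) (b ∷ bs) t q , stop (s ∷ ss) (b ∷ bs) t q ⟩ x →
            [ start (s ∷ ss) (b ∷ bs) t q′ , stop (s ∷ ss) (b ∷ bs) t q′ ⟩ x → q ≡ q′
    cases zero          zero           I J = refl
    cases zero          (suc zero)     I J = pair-pair b I J
    cases zero          (suc (suc q′)) I J = pair-rest b q′ I J
    cases (suc zero)    zero           I J = pair-pair b J I
    cases (suc zero)    (suc zero)     I J = refl
    cases (suc zero)    (suc (suc q′)) I J = pair-rest (not b) q′ I J
    cases (suc (suc q)) zero           I J = pair-rest b q J I
    cases (suc (suc q)) (suc zero)     I J = pair-rest (not b) q J I
    cases (suc (suc q)) (suc (suc q′)) I J = cong (λ i → suc (suc i)) (disjoint ss bs sp′ (t + s) q q′ I J)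

  pair-size : ∀ b s → size b s + size (not b) s ≡ s + (s + κ * s)
  pair-size true  s = +-comm (s + κ * s) s
  pair-size false s = refl

  sum-actual : ∀ {k} (ss : Vec Carrier k) bs → sum (actual ss bs) ≡ totalWork ss
  sum-actual []       []       = trans (Sum.sum-replicate m) (sym (+-identityˡ (m · 1#)))
  sum-actual (s ∷ ss) (b ∷ bs) = trans
    (trans (sym (+-assoc (size b s) (size (not b) s) _)) (cong₂ _+_ (pair-size b s) (sum-actual ss bs)))
    (sym (+-assoc (s + (s + κ * s)) (pairWork ss) (m · 1#)))

  infixr 5 _⨟_
  _⨟_ : ∀ {n} → Carrier → (Fin n → Carrier) → Fin (suc n) → Carrier
  (x ⨟ h) zero    = x
  (x ⨟ h) (suc i) = h i

  workload-rest : ∀ {k s t u} (ss : Vec Carrier k) {g} → Workload (release (s ∷ ss) t) g u →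
                  Workload (release ss (t + s)) (λ q → g (suc (suc q))) u
  workload-rest {u = u} ss W a h 0≤a a≤u h≤ = subst (λ x → x + a ≤ u)
    (trans (+-identityˡ _) (+-identityˡ _))
    (W a (0# ⨟ 0# ⨟ h) 0≤a a≤u
      λ { zero → inj₁ ≤-refl ; (suc zero) → inj₁ ≤-refl ; (suc (suc q)) → h≤ q })

  -- The schedule `stop` never delays a job for the sake of a larger one, which
  -- keeps it ahead at every time x. Here f may be the completion times of any
  -- schedule, and g the work that it has done by time x.
  --
  -- The induction removes the first pair. From t + s on, `stop` treats the later
  -- jobs as if the pair did not exist, so a violation would need both jobs of the
  -- pair to be complete when `stop` has completed only the short one. But then the
  -- pair has taken more than κ s of the time after t + s. That is as much as all
  -- later pairs need and one unit besides, and so `stop` has completed one more of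
  -- the later jobs.
  dominance : ∀ {k} (ss : Vec Carrier k) bs → Spaced ss → ∀ {t x} f {g} → 0# ≤ t →
              Workload (release ss t) g x →
              (∀ q → f q ≤ x → release ss t q ≤ x × actual ss bs q ≤ g q) →
              count f x ℕ.≤ count (stop ss bs t) x
  dominance [] [] sp {t} {x} f 0≤t W done with t ≤? x
  ... | no t≰x = subst (ℕ._≤ count (stop [] [] t) x)
    (sym (count-none f x (λ q → ≰⇒> λ f≤x → t≰x (≤-trans (units-≥ m t q) (proj₁ (done q f≤x))))))
    ℕ.z≤n
  ... | yes t≤x = units-count m t x (count f x) (count≤n f x)
    (subst (λ y → y + t ≤ x) (sym (count·1 f x))
      (W t (λ i → indicator (f i ≤? x) · 1#) 0≤t t≤x weigh))
    where
    weigh : ∀ q → indicator (f q ≤? x) · 1# ≤ 0# ⊎ (t ≤ unitRelease m t q × indicator (f q ≤? x) · 1# ≤ _)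
    weigh q with f q ≤? x
    ... | yes f≤x = inj₂ (units-≥ m t q , ≤-trans (≡⇒≤ (+-identityʳ 1#)) (proj₂ (done q f≤x)))
    ... | no  _   = inj₁ ≤-refl
  dominance {suc k} (s ∷ ss) (b ∷ bs) sp@(0<s , spacing , sp′) {t} {x} f {g} 0≤t W done =
    ℕ.≤-trans (bound (t + s ≤? x) (long ≤? x)) (ℕ.≤-reflexive (arrange b))
    where
    f′ : Fin (jobCount k) → Carrier
    f′ q = f (suc (suc q))

    C : ℕ
    C = count (stop ss bs (t + s)) x

    long : Carrier
    long = t + s + totalWork ss + (s + κ * s)

    rest : count f′ x ℕ.≤ C
    rest = dominance ss bs sp′ f′ (+-nonneg 0≤t (<⇒≤ 0<s)) (workload-rest ss W)
      (λ q → done (suc (suc q)))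

    arrange : ∀ b → indicator (t + s ≤? x) ℕ.+ (indicator (long ≤? x) ℕ.+ C)
              ≡ indicator (pairStart s ss t b + size b s ≤? x) ℕ.+
                (indicator (pairStart s ss t (not b) + size (not b) s ≤? x) ℕ.+ C)
    arrange false = refl
    arrange true  = swap (indicator (t + s ≤? x)) (indicator (long ≤? x))
      where
      swap : ∀ i j → i ℕ.+ (j ℕ.+ C) ≡ j ℕ.+ (i ℕ.+ C)
      swap i j = trans (sym (ℕ.+-assoc i j C)) (trans (cong (ℕ._+ C) (ℕ.+-comm i j)) (ℕ.+-assoc j i C))

    s≤size : ∀ b → s ≤ size b s
    s≤size b = size-≥ b (<⇒≤ 0<s)

    -- Working on the two jobCount of the pair and on `h` for the later jobCount takes time.
    -- All jobs concerned are released from t on, so the work on them fits into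
    -- [t , x).
    pair-load : t ≤ x → ∀ h₀ h₁ h →
                h₀ ≤ 0# ⊎ (t ≤ t × h₀ ≤ g zero) → h₁ ≤ 0# ⊎ (t ≤ t × h₁ ≤ g (suc zero)) →
                (∀ q → h q ≤ 0# ⊎ (f′ q ≤ x × h q ≤ actual ss bs q)) →
                (h₀ + h₁) + sum h + t ≤ x
    pair-load t≤x h₀ h₁ h h₀≤ h₁≤ h≤ = subst (λ y → y + t ≤ x) (sym (+-assoc h₀ h₁ (sum h)))
      (W t (h₀ ⨟ h₁ ⨟ h) 0≤t t≤x
        λ { zero → h₀≤ ; (suc zero) → h₁≤ ; (suc (suc q)) → later q (h≤ q) })
      where
      later : ∀ q → h q ≤ 0# ⊎ (f′ q ≤ x × h q ≤ actual ss bs q) →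
              h q ≤ 0# ⊎ (t ≤ release ss (t + s) q × h q ≤ g (suc (suc q)))
      later q (inj₁ h≤0)         = inj₁ h≤0
      later q (inj₂ (f≤x , h≤p)) = inj₂
        ( ≤-trans (x≤x+y (<⇒≤ 0<s)) (release-≥ ss sp′ (t + s) q)
        , ≤-trans h≤p (proj₂ (done (suc (suc q)) f≤x)))

    idle : ∀ {h₀ h₁} → (h₀ + h₁) + sum {jobCount k} (λ _ → 0#) + t ≤ x → t + (h₀ + h₁) ≤ x
    idle {h₀} {h₁} = subst (_≤ x) (trans
      (cong (λ z → (h₀ + h₁) + z + t) (Sum.sum-replicate-zero (jobCount k)))
      (solve 3 (λ h₀ h₁ t → (h₀ :+ h₁) :+ con 0 :+ t := t :+ (h₀ :+ h₁)) refl h₀ h₁ t))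

    too-early : x < t + s → ∀ q → x < f q
    too-early x<t+s q = ≰⇒> (impossible q)
      where
      impossible : ∀ q → ¬ f q ≤ x
      impossible zero f≤x with done zero f≤x
      ... | t≤x , p≤g = ≤⇒≯ (subst (λ y → t + y ≤ x) (+-identityʳ s)
        (idle (pair-load t≤x s 0# (λ _ → 0#)
          (inj₂ (≤-refl , ≤-trans (s≤size b) p≤g)) (inj₁ ≤-refl) (λ _ → inj₁ ≤-refl)))) x<t+s
      impossible (suc zero) f≤x with done (suc zero) f≤x
      ... | t≤x , p≤g = ≤⇒≯ (subst (λ y → t + y ≤ x) (+-identityˡ s)
        (idle (pair-load t≤x 0# s (λ _ → 0#)
          (inj₁ ≤-refl) (inj₂ (≤-refl , ≤-trans (s≤size (not b)) p≤g)) (λ _ → inj₁ ≤-refl)))) x<t+s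
      impossible (suc (suc q)) f≤x = ≤⇒≯
        (≤-trans (release-≥ ss sp′ (t + s) q) (proj₁ (done (suc (suc q)) f≤x))) x<t+s

    -- If some later job is not counted, comparison with `lateStop` shows that `stop`
    -- is one job ahead among the later ones. If all are counted, then all the work
    -- has been done by time x, and even the long job has ended.
    both : x < long → f zero ≤ x → f (suc zero) ≤ x → suc (count f′ x) ℕ.≤ C
    both x<long f₀≤x f₁≤x with count f′ x ℕ.<? jobCount k
    ... | yes c<N = ℕ.≤-trans
      (lateStop-count k (t + s + pairWork ss) x (suc (count f′ x)) c<N
        (linear-≤ (spacing ⊕ <⇒≤ 0<s ⊕ load)
          (solve 6 (λ c t s b κs x → ((con 1 :+ c) :+ (t :+ s :+ b)) :+ (κs :+ (s :+ x))
              := x :+ ((b :+ con 1) :+ (con 0 :+ ((s :+ (s :+ κs)) :+ c :+ t))))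
            refl (count f′ x · 1#) t s (pairWork ss) (κ * s) x)))
      (count-antitone x (stop≤lateStop ss bs sp′ (t + s)))
      where
      weigh : ∀ q → indicator (f′ q ≤? x) · 1# ≤ 0# ⊎
                    (f′ q ≤ x × indicator (f′ q ≤? x) · 1# ≤ actual ss bs q)
      weigh q with f′ q ≤? x
      ... | yes f≤x = inj₂ (f≤x , ≤-trans (≡⇒≤ (+-identityʳ 1#)) (actual≥1 ss bs sp′ q))
      ... | no  _   = inj₁ ≤-refl

      load : (s + (s + κ * s)) + count f′ x · 1# + t ≤ x
      load = subst₂ (λ y z → y + z + t ≤ x) (pair-size b s) (sym (count·1 f′ x))
        (pair-load (proj₁ (done zero f₀≤x)) (size b s) (size (not b) s) _
          (inj₂ (≤-refl , proj₂ (done zero f₀≤x)))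
          (inj₂ (≤-refl , proj₂ (done (suc zero) f₁≤x))) weigh)
    ... | no c≮N = contradiction x<long (≤⇒≯ (subst (_≤ x)
        (solve 4 (λ T t s κs → (s :+ (s :+ κs)) :+ T :+ t := t :+ s :+ T :+ (s :+ κs))
          refl (totalWork ss) t s (κ * s))
        (subst₂ (λ y z → y + z + t ≤ x) (pair-size b s) (sum-actual ss bs)
          (pair-load (proj₁ (done zero f₀≤x)) (size b s) (size (not b) s) (actual ss bs)
            (inj₂ (≤-refl , proj₂ (done zero f₀≤x)))
            (inj₂ (≤-refl , proj₂ (done (suc zero) f₁≤x)))
            (λ q → inj₂ (count≡n⇒all f′ x (ℕ.≮⇒≥ c≮N) q , ≤-refl))))))

    bound : (short? : Dec (t + s ≤ x)) (long? : Dec (long ≤ x)) →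
            count f x ℕ.≤ indicator short? ℕ.+ (indicator long? ℕ.+ C)
    bound (no x≱) long? = subst (ℕ._≤ indicator long? ℕ.+ C) (sym (count-none f x (too-early (≰⇒> x≱)))) ℕ.z≤n
    bound (yes _) (yes _) = ℕ.+-mono-≤ (indicator-≤1 (f zero ≤? x))
      (ℕ.+-mono-≤ (indicator-≤1 (f (suc zero) ≤? x)) rest)
    bound (yes _) (no x≱) with f zero ≤? x | f (suc zero) ≤? x
    ... | yes f₀≤x | yes f₁≤x = ℕ.s≤s (both (≰⇒> x≱) f₀≤x f₁≤x)
    ... | yes f₀≤x | no _     = ℕ.s≤s rest
    ... | no _     | yes f₁≤x = ℕ.s≤s rest
    ... | no _     | no _     = ℕ.m≤n⇒m≤1+n rest

  -- A long job stays for at most the total work. Each short or unit job is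
  -- processed on arrival, so that its flow time is its size, and these sizes add up
  -- to at most the total work once more.
  flow-upper : ∀ {k} (ss : Vec Carrier k) bs → Spaced ss → ∀ t →
               sum (λ q → stop ss bs t q - release ss t q) ≤ suc k · totalWork ss
  flow-upper [] [] sp t = ≤-trans
    (sum-mono {g = λ _ → 1#} (λ i → sub-from-≤ (≡⇒≤ (+-comm (unitRelease m t i) 1#))))
    (≡⇒≤ (trans (Sum.sum-replicate m)
      (sym (trans (+-identityʳ (0# + m · 1#)) (+-identityˡ (m · 1#))))))
  flow-upper {suc k} (s ∷ ss) (b ∷ bs) sp@(0<s , _ , sp′) t = ≤-trans
    (subst (_≤ s + totalWork (s ∷ ss) + suc k · totalWork ss) (+-assoc _ _ _)
      (pair-flow b ⊕ flow-rest))
    (linear-≤ (<⇒≤ 0<s ⊕ κs-nonneg (<⇒≤ 0<s) ⊕ ·-monoʳ-≤ k totalWork≤)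
      (solve 6 (λ s κs b M X Y → (s :+ ((s :+ (s :+ κs) :+ b) :+ M) :+ ((b :+ M) :+ X)) :+ (s :+ (κs :+ Y))
          := (((s :+ (s :+ κs) :+ b) :+ M) :+ (((s :+ (s :+ κs) :+ b) :+ M) :+ Y)) :+ (con 0 :+ (con 0 :+ X)))
        refl s (κ * s) (pairWork ss) (m · 1#) (k · totalWork ss) (k · totalWork (s ∷ ss))))
    where
    totalWork≤ : totalWork ss ≤ totalWork (s ∷ ss)
    totalWork≤ = linear-≤ (<⇒≤ 0<s ⊕ <⇒≤ 0<s ⊕ κs-nonneg (<⇒≤ 0<s))
      (solve 4 (λ s κs b M → (b :+ M) :+ (s :+ (s :+ κs)) := ((s :+ (s :+ κs) :+ b) :+ M) :+ (con 0 :+ (con 0 :+ con 0)))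
        refl s (κ * s) (pairWork ss) (m · 1#))

    flow : Bool → Carrier
    flow b = pairStart s ss t b + size b s - t

    flow-rest : sum (λ q → stop ss bs (t + s) q - release ss (t + s) q) ≤ suc k · totalWork ss
    flow-rest = flow-upper ss bs sp′ (t + s)

    long-flow : flow true ≤ totalWork (s ∷ ss)
    long-flow = sub-from-≤ (≡⇒≤ (trans (long-stop≡ s ss t)
      (solve 3 (λ t b M → (t :+ b) :+ M := (b :+ M) :+ t) refl t (pairWork (s ∷ ss)) (m · 1#))))

    short-flow : flow false ≤ s
    short-flow = sub-from-≤ (≡⇒≤ (+-comm t s))

    pair-flow : ∀ b → flow b + flow (not b) ≤ s + totalWork (s ∷ ss)
    pair-flow true  = ≤-trans (long-flow ⊕ short-flow) (≡⇒≤ (+-comm (totalWork (s ∷ ss)) s))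
    pair-flow false = short-flow ⊕ long-flow

  -- Both jobs of each pair are released by time T and last until T + m, and each
  -- unit job lasts at least one unit.
  flow-lower : ∀ {k} (ss : Vec Carrier k) → Spaced ss → ∀ {t T} → t + span ss ≤ T →
               m · 1# + (k · (m · 1#) + k · (m · 1#)) ≤ sum (λ q → lateStop k T q - release ss t q)
  flow-lower [] sp {t} {T} t≤T = subst (_≤ sum (λ i → lateStop 0 T i - unitRelease m t i))
    (trans (Sum.sum-replicate m) (sym (trans (cong (m · 1# +_) (+-identityʳ 0#)) (+-identityʳ (m · 1#)))))
    (sum-mono λ i → ≤-sub (≤-trans
      (≡⇒≤ (+-comm 1# (unitRelease m t i)))
      (+-monoˡ-≤ 1# (units-mono m (subst (_≤ T) (+-identityʳ t) t≤T) i))))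
  flow-lower {suc k} (s ∷ ss) (0<s , _ , sp) {t} {T} t≤T = ≤-trans
    (≡⇒≤ (solve 2 (λ M X → M :+ ((M :+ X) :+ (M :+ X)) := M :+ (M :+ (M :+ (X :+ X)))) refl (m · 1#) (k · (m · 1#))))
    (M≤ ⊕ M≤ ⊕ flow-lower ss sp (subst (_≤ T) (sym (+-assoc t s (span ss))) t≤T))
    where
    M≤ : m · 1# ≤ T + m · 1# - t
    M≤ = ≤-sub (≤-trans (≡⇒≤ (+-comm (m · 1#) t)) (+-monoˡ-≤ (m · 1#)
      (≤-trans (x≤x+y (+-nonneg (<⇒≤ 0<s) (span-nonneg ss sp))) t≤T)))

  -- The adversary's choice: of each pair, the job that has received less by time T
  -- is declared short. The pair has received at most s + span ss, where span ss is
  -- at most κ s - 1. So the other job falls short of (1 + κ) s by a unit, and as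
  -- κ ≤ 1/2 and s ≥ 2, half of that amount falls short of s by a unit as well. The
  -- unit jobs are not released before T.
  shorten : ∀ {k} (ss : Vec Carrier k) → Spaced ss → ∀ {t T g} → 0# ≤ t → t + span ss ≡ T →
            Workload (release ss t) g T → (∀ q → T ≤ release ss t q → g q ≤ 0#) →
            ∃ λ bs → ∀ q → g q + 1# ≤ actual ss bs q
  shorten [] sp {t} 0≤t eq W fresh = [] , λ i →
    ≤-trans (+-monoˡ-≤ 1# (fresh i (subst (_≤ unitRelease m t i) (trans (sym (+-identityʳ t)) eq) (units-≥ m t i))))
      (≡⇒≤ (+-identityˡ 1#))
  shorten {suc k} (s ∷ ss) sp@(0<s , spacing , sp′) {t} {T} {g} 0≤t eq W fresh
    with shorten ss sp′ {t + s} (+-nonneg 0≤t (<⇒≤ 0<s)) (trans (+-assoc t s (span ss)) eq)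
           (workload-rest ss W) (λ q → fresh (suc (suc q)))
       | g (suc zero) <? g zero
  ... | bs , ok | less = (b less ∷ bs) , λ
      { zero → first less ; (suc zero) → second less ; (suc (suc q)) → ok q }
    where
    b : Dec (g (suc zero) < g zero) → Bool
    b (yes _) = true
    b (no _)  = false

    g₀ = g zero
    g₁ = g (suc zero)
    Λ  = span ss

    pair-load : ∀ h₀ h₁ → h₀ ≤ 0# ⊎ h₀ ≤ g₀ → h₁ ≤ 0# ⊎ h₁ ≤ g₁ → h₀ + h₁ ≤ s + Λ
    pair-load h₀ h₁ h₀≤ h₁≤ = linear-≤
      (subst₂ (λ z T → (h₀ + (h₁ + z)) + t ≤ T) (Sum.sum-replicate-zero (jobCount k)) (sym eq)
        (W t (h₀ ⨟ h₁ ⨟ λ _ → 0#) 0≤t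
          (subst (t ≤_) eq (x≤x+y (span-nonneg (s ∷ ss) sp)))
          λ { zero → now h₀≤ ; (suc zero) → now h₁≤ ; (suc (suc q)) → inj₁ ≤-refl }))
      (solve 4 (λ h₀ h₁ t y → (h₀ :+ h₁) :+ (t :+ y) := y :+ ((h₀ :+ (h₁ :+ con 0)) :+ t))
        refl h₀ h₁ t (s + Λ))
      where
      now : ∀ {h y} → h ≤ 0# ⊎ h ≤ y → h ≤ 0# ⊎ (t ≤ t × h ≤ y)
      now (inj₁ h≤0) = inj₁ h≤0
      now (inj₂ h≤y) = inj₂ (≤-refl , h≤y)

    long-ok : ∀ {y} → y ≤ s + Λ → y + 1# ≤ s + κ * s
    long-ok {y} y≤ = linear-≤ (y≤ ⊕ span≤pairWork ss sp′ ⊕ spacing)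
      (solve 5 (λ y s Λ b κs → (y :+ con 1) :+ ((s :+ Λ) :+ (b :+ κs)) := (s :+ κs) :+ (y :+ (Λ :+ (b :+ con 1))))
        refl y s Λ (pairWork ss) (κ * s))

    short-ok : ∀ {y z} → y ≤ z → y + z ≤ s + Λ → y + 1# ≤ s
    short-ok {y} {z} y≤z y+z≤ = halve-≤
      (linear-≤ (y≤z ⊕ y+z≤ ⊕ span≤pairWork ss sp′ ⊕ pairWork-nonneg ss sp′ ⊕ gap ss sp)
        (solve 5 (λ y z s Λ b →
            ((y :+ con 1) :+ (y :+ con 1)) :+ (z :+ ((s :+ Λ) :+ (b :+ (b :+ s))))
            := (s :+ s) :+ (y :+ ((y :+ z) :+ (Λ :+ (con 0 :+ ((b :+ con 1) :+ (b :+ con 1)))))))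
          refl y z s Λ (pairWork ss)))

    first : ∀ d → g₀ + 1# ≤ size (b d) s
    first (yes _) = long-ok (subst (_≤ s + Λ) (+-identityʳ g₀) (pair-load g₀ 0# (inj₂ ≤-refl) (inj₁ ≤-refl)))
    first (no g₁≮g₀) = short-ok (≮⇒≥ g₁≮g₀) (pair-load g₀ g₁ (inj₂ ≤-refl) (inj₂ ≤-refl))

    second : ∀ d → g₁ + 1# ≤ size (not (b d)) s
    second (yes g₁<g₀) = short-ok (<⇒≤ g₁<g₀)
      (subst (_≤ s + Λ) (+-comm g₀ g₁) (pair-load g₀ g₁ (inj₂ ≤-refl) (inj₂ ≤-refl)))
    second (no _) = long-ok (subst (_≤ s + Λ) (+-identityˡ g₁) (pair-load 0# g₁ (inj₁ ≤-refl) (inj₂ ≤-refl)))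

-- Choice of the parameters

module Parameters (ℝ : RealNumbers) where
  open RealNumbers ℝ
  open OrderedField ℝ

  -- κ is half of the minimum of μ - 1 and 1.
  stretch : ∀ {μ} → 1# < μ → Stretch ℝ μ
  stretch {μ} 1<μ with capped (μ - 1# ≤? 1#)
    where
    capped : Dec (μ - 1# ≤ 1#) → ∃ λ δ → 0# < δ × δ ≤ 1# × δ + 1# ≤ μ
    capped (yes ≤1) = μ - 1# , <⇒0<- 1<μ , ≤1
                    , ≡⇒≤ (-+-cancel μ 1#)
    capped (no  ≰1) = 1# , 0<1 , ≤-refl , ≤-from-sub (<⇒≤ (≰⇒> ≰1))
  ... | δ , 0<δ , δ≤1 , δ+1≤μ with half 0<δ
  ... | κ , 0<κ , κ+κ≡δ = record
    { κ     = κ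
    ; 0<κ   = 0<κ
    ; 2κ≤1  = subst (_≤ 1#) (sym κ+κ≡δ) δ≤1
    ; 1+κ<μ = <-≤-trans
        (subst (1# + κ <_) (trans (+-comm 1# (κ + κ)) (cong (_+ 1#) κ+κ≡δ)) (+-monoʳ-< 1# (x<x+y 0<κ)))
        δ+1≤μ
    }

  ·-as-* : ∀ n x → n · x ≡ (n · 1#) * x
  ·-as-* zero    x = sym (zeroˡ x)
  ·-as-* (suc n) x = sym (trans (distribʳ x 1# (n · 1#))
    (cong₂ _+_ (*-identityˡ x) (sym (·-as-* n x))))

  -- For k pairs of total work B and m unit jobs, the bounds on the optimal flow
  -- time and on the flow time of the algorithm are a factor c apart.
  Separates : Carrier → ℕ → Carrier → ℕ → Set
  Separates c k B m = ∀ {F} → 0# ≤ F → F ≤ suc k · (B + m · 1#) →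
                      c * F < m · 1# + (k · (m · 1#) + k · (m · 1#))

  -- As m grows, the ratio of the bounds tends to (2 k + 1) / (k + 1), which exceeds
  -- c once (k + 1) (2 - c) > 1. With γ = (k + 1) (2 - c) - 1, the constant term
  -- c (k + 1) B is outweighed as soon as it is less than γ m. A negative c is
  -- replaced by 0 first.
  horizon : ∀ {c} → c < 1# + 1# → ∃ λ k → ∀ B → ∃ λ m → Separates c k B m
  horizon {c} c<2 with clipped (0# ≤? c)
    where
    clipped : Dec (0# ≤ c) → ∃ λ c⁺ → 0# ≤ c⁺ × c ≤ c⁺ × c⁺ < 1# + 1#
    clipped (yes 0≤c) = c , 0≤c , ≤-refl , c<2
    clipped (no  0≰c) = 0# , ≤-refl , <⇒≤ (≰⇒> 0≰c) , +-pos-nonneg 0<1 (<⇒≤ 0<1)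
  ... | c⁺ , 0≤c⁺ , c≤c⁺ , c⁺<2 with positiveInverse (<⇒0<- c⁺<2)
  ... | d⁻¹ , _ , dd⁻¹≡1 with archimedean d⁻¹
  ... | k , d⁻¹<K = k , units-needed
    where
    d = (1# + 1#) - c⁺
    K = k · 1#
    γ = d * (1# + K) - 1#

    0<d : 0# < d
    0<d = <⇒0<- c⁺<2

    0<γ : 0# < γ
    0<γ = <⇒0<- (subst (_< d * (1# + K)) dd⁻¹≡1
      (<-≤-trans (*-monoʳ-< 0<d d⁻¹<K)
        (*-monoʳ-≤ (<⇒≤ 0<d) (subst (_≤ 1# + K) (+-identityˡ K) (+-monoˡ-≤ K (<⇒≤ 0<1))))))

    units-needed : ∀ B → ∃ λ m → Separates c k B m
    units-needed B with positiveInverse 0<γ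
    ... | γ⁻¹ , _ , γγ⁻¹≡1 with archimedean (γ⁻¹ * (c⁺ * ((1# + K) * B)))
    ... | m , <M = m , λ {F} 0≤F F≤V →
      ≤-<-trans (subst₂ _≤_ (*-comm F c) (*-comm F c⁺) (*-monoʳ-≤ 0≤F c≤c⁺))
        (≤-<-trans (*-monoʳ-≤ 0≤c⁺ (subst (F ≤_) (·-as-* (suc k) (B + M)) F≤V))
          (subst (λ y → c⁺ * ((1# + K) * (B + M)) < M + (y + y)) (sym (·-as-* k M))
            (linear-< (+-monoˡ-< M w<γM) identity)))
      where
      M = m · 1#
      w = c⁺ * ((1# + K) * B)

      w<γM : w < γ * M
      w<γM = subst (_< γ * M)
        (trans (sym (*-assoc γ γ⁻¹ w)) (trans (cong (_* w) γγ⁻¹≡1) (*-identityˡ w)))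
        (*-monoʳ-< 0<γ <M)

      γM+M : γ * M + M ≡ (d * (1# + K)) * M
      γM+M = trans (solve 2 (λ γ M → γ :* M :+ M := (γ :+ con 1) :* M) refl γ M)
        (cong (_* M) (-+-cancel (d * (1# + K)) 1#))

      identity : c⁺ * ((1# + K) * (B + M)) + (γ * M + M) ≡ (M + (K * M + K * M)) + (w + M)
      identity = trans (cong (c⁺ * ((1# + K) * (B + M)) +_) γM+M)
        (trans (solve 5 (λ c d K B M → c :* ((con 1 :+ K) :* (B :+ M)) :+ (d :* (con 1 :+ K)) :* M
                   := (d :+ c) :* ((con 1 :+ K) :* M) :+ c :* ((con 1 :+ K) :* B)) refl c⁺ d K B M)
          (trans (cong (λ y → y * ((1# + K) * M) + w) (-+-cancel (1# + 1#) c⁺))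
            (solve 3 (λ K M w → (con 1 :+ con 1) :* ((con 1 :+ K) :* M) :+ w
                := (M :+ (K :* M :+ K :* M)) :+ (w :+ M)) refl K M w)))

-- The adversary against a given algorithm

module Refutation (ℝ : RealNumbers) (leb : LebesgueMeasure ℝ)
  {μ : RealNumbers.Carrier ℝ} (K : Stretch ℝ μ) (ALG : SPPT.OnlineAlgorithm ℝ leb)
  (m : ℕ) {k : ℕ} (ss : Vec (RealNumbers.Carrier ℝ) k) (sp : Scales.Spaced ℝ K ss) where
  open RealNumbers ℝ
  open OrderedField ℝ
  open SPPT ℝ leb
  open Stretch K
  open Scales ℝ K
  open Counting ℝ
  open Workloads ℝ
  open ScheduleFacts ℝ leb
  open SlotSchedule ℝ leb
  open Adaptivity ℝ leb
  open Cascade ℝ K m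
  open OnlineAlgorithm ALG using (schedule)
  open HiddenSizes (release ss 0#) (predicted ss)
    (release-≥ ss sp 0#) (predicted-pos ss sp) (release-sorted ss sp 0#)

  T : Carrier
  T = span ss

  -- The algorithm is first run with every job long; its behaviour on this input
  -- until time T decides which jobs become short.
  probeSize : Fin (jobCount k) → Carrier
  probeSize q = size true (predicted ss q)

  probe-pos : ∀ q → 0# < probeSize q
  probe-pos q = <-≤-trans (predicted-pos ss sp q) (size-≥ true (<⇒≤ (predicted-pos ss sp q)))

  probe : Input
  probe = withSizes probeSize probe-pos

  module Probe = Schedule (schedule probe)

  -- Only the inequality matters from here on, not how the choice came about.
  abstract
    choice : ∃ λ bs → ∀ q → Probe.received q T + 1# ≤ actual ss bs q
    choice = shorten ss sp ≤-refl (+-identityˡ T) (workload (schedule probe) T)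
      (λ q T≤r → ≡⇒≤ (received-unreleased (schedule probe) q T≤r))

  bs : Vec Bool k
  bs = proj₁ choice

  actual-pos : ∀ q → 0# < actual ss bs q
  actual-pos q = <-≤-trans 0<1 (actual≥1 ss bs sp q)

  Q : Input
  Q = withSizes (actual ss bs) actual-pos

  module Alg = Schedule (schedule Q)

  within : PredictionsWithin μ Q
  within q = size-≥ (isLong bs q) (<⇒≤ (predicted-pos ss sp q)) ,
    ≤-<-trans (size-≤ (isLong bs q) (<⇒≤ (predicted-pos ss sp q)))
      (subst₂ _<_
        (trans (*-comm x (1# + κ)) (trans (distribʳ x 1# κ) (cong (_+ κ * x) (*-identityˡ x))))
        (*-comm x μ)
        (*-monoʳ-< (predicted-pos ss sp q) 1+κ<μ))
    where x = predicted ss q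

  OPT : Schedule Q
  OPT = slotSchedule Q (start ss bs 0#) (released ss bs sp 0#) (disjoint ss bs sp 0#)

  flow-antitone : ∀ (f g : Fin (jobCount k) → Carrier) → (∀ x → count f x ℕ.≤ count g x) →
                  sum (λ q → g q - release ss 0# q) ≤ sum (λ q → f q - release ss 0# q)
  flow-antitone f g dom = subst₂ _≤_ (sym (Sum.∑-distrib-+ g r⁻)) (sym (Sum.∑-distrib-+ f r⁻))
    (+-monoˡ-≤ (sum r⁻) (count-dominance f g dom))
    where
    r⁻ : Fin (jobCount k) → Carrier
    r⁻ q = - release ss 0# q

  optimal : IsOptimal OPT
  optimal S = flow-antitone (Schedule.completion S) (stop ss bs 0#) λ x →
    dominance ss bs sp (Schedule.completion S) ≤-refl (workload S x)
      (λ q c≤x → ≤-trans (release≤completion S q) c≤x , completed⇒received S q c≤x)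

  OPT-nonneg : 0# ≤ flowTime OPT
  OPT-nonneg = subst (_≤ flowTime OPT) (Sum.sum-replicate-zero (jobCount k))
    (sum-mono λ q → ≤-sub (subst (_≤ stop ss bs 0# q) (sym (+-identityˡ (release ss 0# q)))
      (≤-trans (released ss bs sp 0# q) (x≤x+y (<⇒≤ (actual-pos q))))))

  remaining : ∀ q → Alg.received q T + 1# ≤ actual ss bs q
  remaining q = subst (λ y → y + 1# ≤ actual ss bs q)
    (sym (indistinguishable ALG probe-pos actual-pos T
      (λ q → <-≤-trans (unfinished q) (size-≤ (isLong bs q) (<⇒≤ (predicted-pos ss sp q))))
      unfinished q))
    (proj₂ choice q)
    where
    unfinished : ∀ q → Probe.received q T < actual ss bs q
    unfinished q = <-≤-trans
      (x<x+y 0<1)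
      (proj₂ choice q)

  -- The reference times complete one job per unit of time from T on, the most that
  -- the algorithm can achieve.
  ALG-slow : ∀ x → count Alg.completion x ℕ.≤ count (lateStop k T) x
  ALG-slow x = cases (completion-rate (schedule Q) (span-nonneg ss sp) remaining x)
    where
    n = count Alg.completion x

    cases : n ≡ 0 ⊎ n · 1# + T ≤ x → n ℕ.≤ count (lateStop k T) x
    cases (inj₁ none) = ℕ.≤-trans (ℕ.≤-reflexive none) ℕ.z≤n
    cases (inj₂ rate) = lateStop-count k T x n (count≤n Alg.completion x) rate

  ALG-lower : m · 1# + (k · (m · 1#) + k · (m · 1#)) ≤ flowTime (schedule Q)
  ALG-lower = ≤-trans (flow-lower ss sp (≡⇒≤ (+-identityˡ T)))
    (flow-antitone Alg.completion (lateStop k T) ALG-slow)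

  OPT-upper : flowTime OPT ≤ suc k · (pairWork ss + m · 1#)
  OPT-upper = flow-upper ss bs sp 0#

  refuted : ∀ {c} → Parameters.Separates ℝ c k (pairWork ss) m →
            ∃ λ (Q : Input) → PredictionsWithin μ Q ×
              (∃ λ (OPT : Schedule Q) → IsOptimal OPT ×
                 c * flowTime OPT < flowTime (OnlineAlgorithm.schedule ALG Q))
  refuted separates = Q , within , OPT , optimal ,
    <-≤-trans (separates OPT-nonneg OPT-upper) ALG-lower

theoremC1 : (ℝ : RealNumbers) (leb : LebesgueMeasure ℝ) →
    let open RealNumbers ℝ
        open SPPT ℝ leb
    in (μ : Carrier) → 1# < μ →
       (ALG : OnlineAlgorithm) →
       (c : Carrier) → c < 1# + 1# →
       ∃ λ (Q : Input) → PredictionsWithin μ Q ×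
         (∃ λ (OPT : Schedule Q) → IsOptimal OPT ×
            c * flowTime OPT < flowTime (OnlineAlgorithm.schedule ALG Q))
theoremC1 ℝ leb μ 1<μ ALG c c<2 = with-horizon (horizon c<2)
  where
  open RealNumbers ℝ
  open SPPT ℝ leb
  open Parameters ℝ

  K : Stretch ℝ μ
  K = stretch 1<μ

  open Scales ℝ K

  Goal : Set
  Goal = ∃ λ (Q : Input) → PredictionsWithin μ Q ×
    (∃ λ (OPT : Schedule Q) → IsOptimal OPT ×
       c * flowTime OPT < flowTime (OnlineAlgorithm.schedule ALG Q))

  with-horizon : (∃ λ k → ∀ B → ∃ λ m → Separates c k B m) → Goal
  with-horizon (k , units-needed) = with-scales (spaced k)
    where
    with-scales : (∃ λ (ss : Vec Carrier k) → Spaced ss) → Goal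
    with-scales (ss , sp) = with-units (units-needed (pairWork ss))
      where
      with-units : (∃ λ m → Separates c k (pairWork ss) m) → Goal
      with-units (m , separates) = Refutation.refuted ℝ leb K ALG m ss sp separates
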